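{- Let $q$ be a prime power and let $A$ be a nonempty subset of $\mathbb{F}_q$. Suppose that there is a positive constant $K$ such that $|A|\le q/(4K)$ and \[ D_\times(A)\ \ge\ \frac{|A|^8}{q}+\frac{3q|A|^5}{K}. \] Then there exists a subset $X\subseteq\mathbb{F}_q^*$ such that $E(A,\xi A)\ge |A|^3/K$ for all $\xi\in X$ and \[ \frac{q}{K|A|}\ \le\ |X|\ \le\ \frac{4Kq}{3|A|}. \]
   Context: $\mathbb{F}_q$ is the finite field with $q$ elements and $\mathbb{F}_q^*=\mathbb{F}_q\setminus\{0\}$. For $A\subseteq\mathbb{F}_q$, \[ D_\times(A)=|\{(a_1,\dots,a_8)\in A^8: (a_1-a_2)(a_3-a_4)=(a_5-a_6)(a_7-a_8)\}|, \] and for $\xi\in\mathbb{F}_q^*$, \[ E(A,\xi A)=|\{(a_1,a_2,a_3,a_4)\in A^4: a_1-a_2=\xi(a_3-a_4)\}|. \] -}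

module Defs where

open import Level using (0ℓ; _⊔_) renaming (suc to lsuc)
open import Algebra.Apartness.Bundles using (HeytingField; HeytingCommutativeRing)
open import Algebra.Bundles using (CommutativeRing)
import Algebra.Definitions.RawMonoid as RawMonoidDefs
open import Data.Fin.Base using (Fin)
open import Data.Fin.Properties using () renaming (_≟_ to _≟ᶠ_)
import Data.Fin.Subset as Subset
open import Data.Fin.Subset using (Subset; Nonempty; ∣_∣)
open import Data.Fin.Subset.Properties using (x∈p⇒∣p-x∣<∣p∣) renaming (_∈?_ to _∈ᶠ?_)
open import Data.List.Base using (List; []; _∷_; allFin; cartesianProductWith; filter; length; map)
open import Data.Nat.Base using (ℕ; zero; suc; NonZero; >-nonZero; _^_; z≤n) renaming (_≤_ to _≤ⁿ_)
open import Data.Nat.Primality using (Prime; prime⇒nonZero)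
import Data.Nat.Properties as ℕₚ
open import Data.Product.Base using (∃₂; ∃-syntax; _×_; _,_; proj₁)
import Data.Rational.Base as ℚ
import Data.Rational.Properties as ℚₚ
open import Data.Sum.Base using (_⊎_; inj₁; inj₂)
open import Data.Vec.Base using (Vec; []; _∷_)
open import Function.Bundles using (Inverse; Injection)
open import Function.Properties.Inverse using (Inverse⇒Injection)
open import Relation.Binary.Core using (Rel)
open import Relation.Binary.Definitions using (Decidable; tri<; tri≈; tri>)
open import Relation.Binary.PropositionalEquality using (_≡_; refl) renaming (setoid to ≡-setoid)
open import Relation.Binary.Structures using (IsStrictPartialOrder)
open import Relation.Nullary using (contradiction; ¬_; Dec)
open import Relation.Nullary.Decidable using (map′)
open import Relation.Unary using (Pred)

IsPrimePower : ℕ → Set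
IsPrimePower q = ∃₂ λ p k → Prime p × 1 ≤ⁿ k × q ≡ p ^ k

primePower⇒nonZero : ∀ {q} → IsPrimePower q → NonZero q
primePower⇒nonZero (p , k , p-prime , _ , refl) =
  ℕₚ.m^n≢0 p k {{prime⇒nonZero p-prime}}

nonempty⇒nonZero : ∀ {n} {A : Subset n} → Nonempty A → NonZero ∣ A ∣
nonempty⇒nonZero (_ , x∈A) = >-nonZero (ℕₚ.≤-<-trans z≤n (x∈p⇒∣p-x∣<∣p∣ x∈A))

-- All k-tuples with entries in xs, i.e. the Cartesian power xsᵏ.
tuples : ∀ {a} {X : Set a} (k : ℕ) → List X → List (Vec X k)
tuples zero    xs = [] ∷ []
tuples (suc k) xs = cartesianProductWith _∷_ xs (tuples k xs)

-- A field with exactly q elements.  The carrier is a setoid, so "q elements"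
-- means q classes for _≈_.  Since a finite search decides invertibility, the
-- apartness _#_ of the underlying field is here equivalent to ¬ (x ≈ y).
record FiniteField c ℓ₁ ℓ₂ (q : ℕ) : Set (lsuc (c ⊔ ℓ₁ ⊔ ℓ₂)) where
  field
    heytingField : HeytingField c ℓ₁ ℓ₂

  open HeytingField heytingField public

  field
    enumeration : Inverse setoid (≡-setoid (Fin q))

  open Inverse enumeration public
    using () renaming (to to index; from to element)

  infix 4 _≟_

  _≟_ : Decidable _≈_
  x ≟ y = map′ injective (Inverse.to-cong enumeration) (index x ≟ᶠ index y)
    where open Injection (Inverse⇒Injection enumeration) using (injective)

module FieldSubsets {c ℓ₁ ℓ₂ q} (F : FiniteField c ℓ₁ ℓ₂ q) where

  open FiniteField F

  infix 4 _∈_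

  -- Subsets of the field are given through the enumeration of its elements.
  _∈_ : Carrier → Subset q → Set
  x ∈ A = index x Subset.∈ A

  NonZeroElement : Pred Carrier ℓ₁
  NonZeroElement x = ¬ (x ≈ 0#)

  elements : Subset q → List Carrier
  elements A = map element (filter (_∈ᶠ? A) (allFin q))

  ProductEquation : Pred (Vec Carrier 8) ℓ₁
  ProductEquation (a₁ ∷ a₂ ∷ a₃ ∷ a₄ ∷ a₅ ∷ a₆ ∷ a₇ ∷ a₈ ∷ []) =
    (a₁ - a₂) * (a₃ - a₄) ≈ (a₅ - a₆) * (a₇ - a₈)

  productEquation? : ∀ v → Dec (ProductEquation v)
  productEquation? (a₁ ∷ a₂ ∷ a₃ ∷ a₄ ∷ a₅ ∷ a₆ ∷ a₇ ∷ a₈ ∷ []) =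
    (a₁ - a₂) * (a₃ - a₄) ≟ (a₅ - a₆) * (a₇ - a₈)

  D× : Subset q → ℕ
  D× A = length (filter productEquation? (tuples 8 (elements A)))

  EnergyEquation : Carrier → Pred (Vec Carrier 4) ℓ₁
  EnergyEquation ξ (a₁ ∷ a₂ ∷ a₃ ∷ a₄ ∷ []) = a₁ - a₂ ≈ ξ * (a₃ - a₄)

  energyEquation? : ∀ ξ v → Dec (EnergyEquation ξ v)
  energyEquation? ξ (a₁ ∷ a₂ ∷ a₃ ∷ a₄ ∷ []) = a₁ - a₂ ≟ ξ * (a₃ - a₄)

  -- E A ξ is E(A, ξA).
  E : Subset q → Carrier → ℕ
  E A ξ = length (filter (energyEquation? ξ) (tuples 4 (elements A)))

-- Ordered fields in the constructive sense: the apartness is x < y or y < x,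
-- and x ≤ y is the negation of y < x.  Classically these are exactly the
-- totally ordered fields; the real numbers form one both classically and
-- constructively.
record OrderedField c ℓ₁ ℓ₂ ℓ₃ : Set (lsuc (c ⊔ ℓ₁ ⊔ ℓ₂ ⊔ ℓ₃)) where
  infix 4 _<_ _≤_ _≥_
  infixl 7 _/_ _*₊_

  field
    heytingField : HeytingField c ℓ₁ ℓ₂

  open HeytingField heytingField public

  field
    _<_                  : Rel Carrier ℓ₃
    isStrictPartialOrder : IsStrictPartialOrder _≈_ _<_
    <⇒#                  : ∀ {x y} → x < y → x # y
    #⇒<⊎>                : ∀ {x y} → x # y → x < y ⊎ y < x
    0<1                  : 0# < 1#
    +-monoˡ-<            : ∀ z {x y} → x < y → x + z < y + z
    0<*                  : ∀ {x y} → 0# < x → 0# < y → 0# < x * y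

  module <-Order = IsStrictPartialOrder isStrictPartialOrder

  _≤_ : Rel Carrier ℓ₃
  x ≤ y = ¬ (y < x)

  _≥_ : Rel Carrier ℓ₃
  x ≥ y = y ≤ x

  commutativeRing : CommutativeRing c ℓ₁
  commutativeRing = HeytingCommutativeRing.commutativeRing heytingCommutativeRing

  open RawMonoidDefs (CommutativeRing.+-rawMonoid commutativeRing)
    using () renaming (_×_ to _·_)

  ⟦_⟧ : ℕ → Carrier
  ⟦ n ⟧ = n · 1#

  Positive : Set (c ⊔ ℓ₃)
  Positive = ∃[ x ] 0# < x

  -- Division is only defined for a positive divisor.
  _/_ : Carrier → Positive → Carrier
  x / (y , 0<y) = x * proj₁ (#⇒invertible (#-sym (<⇒# 0<y)))

  0<⟦_⟧ : ∀ n .{{_ : NonZero n}} → 0# < ⟦ n ⟧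
  0<⟦ suc zero ⟧    = <-Order.<-respʳ-≈ (sym (+-identityʳ 1#)) 0<1
  0<⟦ suc (suc n) ⟧ = <-Order.trans 0<⟦ suc n ⟧
    (<-Order.<-respˡ-≈ (+-identityˡ ⟦ suc n ⟧) (+-monoˡ-< ⟦ suc n ⟧ 0<1))

  ⟦_⟧₊ : ∀ n .{{_ : NonZero n}} → Positive
  ⟦ n ⟧₊ = ⟦ n ⟧ , 0<⟦ n ⟧

  _*₊_ : Positive → Positive → Positive
  (x , 0<x) *₊ (y , 0<y) = x * y , 0<* 0<x 0<y

ℚ-orderedField : OrderedField 0ℓ 0ℓ 0ℓ 0ℓ
ℚ-orderedField = record
  { heytingField         = ℚₚ.heytingField
  ; _<_                  = ℚ._<_
  ; isStrictPartialOrder = ℚₚ.<-isStrictPartialOrder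
  ; <⇒#                  = ℚₚ.<⇒≢
  ; #⇒<⊎>                = λ {x} {y} → compare x y
  ; 0<1                  = ℚₚ.positive⁻¹ ℚ.1ℚ
  ; +-monoˡ-<            = ℚₚ.+-monoˡ-<
  ; 0<*                  = λ {x} {y} 0<x 0<y → ℚₚ.positive⁻¹ (x ℚ.* y)
      {{ℚₚ.pos*pos⇒pos x {{ℚ.positive 0<x}} y {{ℚ.positive 0<y}}}}
  }
  where
  compare : ∀ x y → ¬ (x ≡ y) → x ℚ.< y ⊎ y ℚ.< x
  compare x y x≢y with ℚₚ.<-cmp x y
  ... | tri< x<y _ _ = inj₁ x<y
  ... | tri≈ _ x≡y _ = contradiction x≡y x≢y
  ... | tri> _ _ y<x = inj₂ y<x

{-# OPTIONS --safe #-}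
-- Write n = |A|.  Counting incidences of pairs of differences with points of the
-- projective line gives ∑ E = n⁴ + q n² - n³ and ∑ E² = D× + q n⁴ - n⁶, the sums
-- running over all ξ in the field.  By Cauchy–Schwarz e = E - n⁴/q is nonnegative,
-- so these bound ∑ e by q n² and evaluate ∑ e².  Put M = q D× - n⁸.  The
-- hypotheses force 12 q n⁶ ≤ M and K ≥ K₀ := 3 q² n⁵ / M, and the conclusions for
-- the rational K₀ imply those for K; hence X may be taken to be the decidable set
-- of nonzero ξ with E ≥ n³/K₀.  On X the excess e is at least 3 n³ / (4 K₀), so the
-- bound on ∑ e limits |X| from above.  Off X that bound and e < n³/K₀ absorb a fixed
-- part of ∑ e², and the rest, together with e ≤ n³, bounds |X| from below.
module Submission where

open import Defs
open import Data.Fin.Subset using (Subset; Nonempty; ∣_∣)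
open import Data.Nat.Base using (ℕ; _^_)
open import Data.Product.Base using (_×_; _,_; ∃-syntax)

open import Algebra.Apartness.Bundles using (module HeytingCommutativeRing)
import Algebra.Apartness.Properties.HeytingCommutativeRing as HeytingProperties
open import Algebra.Bundles using (CommutativeRing)
import Algebra.Properties.CommutativeSemigroup as CommutativeSemigroupProperties
import Algebra.Properties.Group as GroupProperties
import Algebra.Properties.Monoid.Mult as MonoidMult
import Algebra.Properties.Semiring.Mult as SemiringMult
open import Data.Bool.Base using (if_then_else_; true; false)
open import Data.Fin.Base using (Fin; zero; suc)
import Data.Fin.Properties as Finₚ
open Finₚ using () renaming (_≟_ to _≟ᶠ_)
import Data.Fin.Subset as Subset
open Subset using (inside; outside; ⁅_⁆) renaming (_-_ to _∖_)
import Data.Fin.Subset.Properties as Subsetₚ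
open Subsetₚ using () renaming (_∈?_ to _∈ᶠ?_)
open import Data.List.Base
  using (List; []; _∷_; _++_; allFin; cartesianProductWith; filter; length; map)
import Data.List.Properties as Listₚ
open import Data.Nat.Base as ℕ using (zero; suc)
import Data.Nat.Properties as ℕₚ
open import Data.Nat.Solver using (module +-*-Solver)
open import Data.Product.Base using (proj₁; proj₂)
open import Data.Sum.Base using (_⊎_; inj₁; inj₂)
import Data.Vec.Base as Vec
open Vec using (Vec; []; _∷_; there)
import Data.Vec.Properties as Vecₚ
open import Function.Base using (_∘_; id; it)
open import Function.Bundles using (Inverse)
open import Level using (Level; 0ℓ)
import Relation.Binary.PropositionalEquality as ≡
open ≡ using (_≡_)
import Relation.Binary.Reasoning.Setoid as SetoidReasoning
open import Relation.Nullary using (Dec; yes; no; ¬_; does; contradiction)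
open import Relation.Nullary.Decidable using (dec-true)
open import Relation.Unary using (Pred; Decidable)

-- The order of `R` is not assumed decidable, so the set of `ξ` with E at least n³/K cannot simply
-- be formed as a `Subset q`; comparing with K₀ is a comparison of natural numbers. Going back from
-- K₀ to K is harmless because every conclusion only weakens as K grows: n³/K and q/(K n) fall,
-- 4Kq/(3n) rises.
--
-- The constant 12 is 3 · 4, from the term 3q|A|⁵/K and from |A| ≤ q/(4K). The inequality 12 q n⁶ ≤
-- M says that n⁴/q ≤ n³/(4K₀): the main term of E is at most a quarter of the threshold, which
-- leaves the three quarters. The same inequality pays for all error terms of the lower bound,
-- including the loss of the slope ξ = 0, which the moment sums contain and the theorem excludes.
--
-- Up to the last step everything is multiplied out and kept in `ℕ`, with negative terms moved
-- across the equality.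

module Counting where

  open import Data.Nat.Base using (_+_; _*_; _∸_; _≤_; z≤n; s≤s; NonZero)
  open import Data.Nat.ListAction using (sum)
  open import Data.Nat.ListAction.Properties using (sum-++)
  open import Data.Nat.Properties hiding (_≟_)
  open import Relation.Binary.PropositionalEquality

  private
    variable
      a p : Level
      A B C : Set a
      P Q : Set p

  -- Indicators, finite sums and Cauchy-Schwarz in the natural numbers.

  𝟙 : Dec P → ℕ
  𝟙 P? = if does P? then 1 else 0

  𝟙-true : (P? : Dec P) → P → 𝟙 P? ≡ 1
  𝟙-true (yes _) _ = refl
  𝟙-true (no ¬P) P = contradiction P ¬P

  𝟙-false : (P? : Dec P) → ¬ P → 𝟙 P? ≡ 0
  𝟙-false (yes P) ¬P = contradiction P ¬P
  𝟙-false (no _)  _  = refl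

  𝟙-cong : (P? : Dec P) (Q? : Dec Q) → (P → Q) → (Q → P) → 𝟙 P? ≡ 𝟙 Q?
  𝟙-cong (yes P) Q? P⇒Q Q⇒P = sym (𝟙-true Q? (P⇒Q P))
  𝟙-cong (no ¬P) Q? P⇒Q Q⇒P = sym (𝟙-false Q? (¬P ∘ Q⇒P))

  𝟙≤1 : (P? : Dec P) → 𝟙 P? ≤ 1
  𝟙≤1 (yes _) = ≤-refl
  𝟙≤1 (no _)  = z≤n

  𝟙-idem : (P? : Dec P) → 𝟙 P? * 𝟙 P? ≡ 𝟙 P?
  𝟙-idem (yes _) = refl
  𝟙-idem (no _)  = refl

  ∑ : List A → (A → ℕ) → ℕ
  ∑ xs f = sum (map f xs)

  syntax ∑ xs (λ x → e) = ∑[ x ← xs ] e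

  ∑-cong : ∀ (xs : List A) {f g : A → ℕ} → (∀ x → f x ≡ g x) → ∑ xs f ≡ ∑ xs g
  ∑-cong xs f≗g = cong sum (Listₚ.map-cong f≗g xs)

  ∑∑-cong : ∀ (xs : List A) (ys : List B) {f g : A → B → ℕ} → (∀ x y → f x y ≡ g x y) →
            ∑[ x ← xs ] ∑[ y ← ys ] f x y ≡ ∑[ x ← xs ] ∑[ y ← ys ] g x y
  ∑∑-cong xs ys f≗g = ∑-cong xs λ x → ∑-cong ys (f≗g x)

  ∑-mono : ∀ (xs : List A) {f g : A → ℕ} → (∀ x → f x ≤ g x) → ∑ xs f ≤ ∑ xs g
  ∑-mono []       f≤g = z≤n
  ∑-mono (x ∷ xs) f≤g = +-mono-≤ (f≤g x) (∑-mono xs f≤g)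

  ∑-+ : ∀ (xs : List A) (f g : A → ℕ) → ∑[ x ← xs ] (f x + g x) ≡ ∑ xs f + ∑ xs g
  ∑-+ []       f g = refl
  ∑-+ (x ∷ xs) f g rewrite ∑-+ xs f g =
    solve 4 (λ a b c d → (a :+ b) :+ (c :+ d) := (a :+ c) :+ (b :+ d)) refl
      (f x) (g x) (∑ xs f) (∑ xs g)
    where open +-*-Solver

  ∑-*ˡ : ∀ (xs : List A) c (f : A → ℕ) → ∑[ x ← xs ] (c * f x) ≡ c * ∑ xs f
  ∑-*ˡ []       c f = sym (*-zeroʳ c)
  ∑-*ˡ (x ∷ xs) c f rewrite ∑-*ˡ xs c f = sym (*-distribˡ-+ c (f x) (∑ xs f))

  ∑-*ʳ : ∀ (xs : List A) (f : A → ℕ) c → ∑[ x ← xs ] (f x * c) ≡ ∑ xs f * c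
  ∑-*ʳ xs f c = trans (∑-cong xs λ x → *-comm (f x) c) (trans (∑-*ˡ xs c f) (*-comm c (∑ xs f)))

  ∑-const : ∀ (xs : List A) c → ∑[ _ ← xs ] c ≡ length xs * c
  ∑-const []       c = refl
  ∑-const (x ∷ xs) c = cong (c +_) (∑-const xs c)

  ∑-*-∑ : ∀ (xs : List A) (ys : List B) (f : A → ℕ) (g : B → ℕ) →
          ∑ xs f * ∑ ys g ≡ ∑[ x ← xs ] ∑[ y ← ys ] (f x * g y)
  ∑-*-∑ xs ys f g = trans (sym (∑-*ʳ xs f (∑ ys g))) (∑-cong xs λ x → sym (∑-*ˡ ys (f x) g))

  ∑-swap : ∀ (xs : List A) (ys : List B) (f : A → B → ℕ) →
           ∑[ x ← xs ] ∑[ y ← ys ] f x y ≡ ∑[ y ← ys ] ∑[ x ← xs ] f x y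
  ∑-swap []       ys f = sym (trans (∑-const ys 0) (*-zeroʳ (length ys)))
  ∑-swap (x ∷ xs) ys f = trans (cong (∑ ys (f x) +_) (∑-swap xs ys f))
                               (sym (∑-+ ys (f x) (λ y → ∑[ x ← xs ] f x y)))

  ∑-map : ∀ (h : A → B) (xs : List A) (f : B → ℕ) → ∑ (map h xs) f ≡ ∑ xs (f ∘ h)
  ∑-map h xs f = cong sum (sym (Listₚ.map-∘ xs))

  ∑-cartesian : ∀ (h : A → B → C) (xs : List A) (ys : List B) (f : C → ℕ) →
                ∑ (cartesianProductWith h xs ys) f ≡ ∑[ x ← xs ] ∑[ y ← ys ] f (h x y)
  ∑-cartesian h []       ys f = refl
  ∑-cartesian h (x ∷ xs) ys f = begin
    sum (map f (map (h x) ys ++ cartesianProductWith h xs ys))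
      ≡⟨ cong sum (Listₚ.map-++ f (map (h x) ys) _) ⟩
    sum (map f (map (h x) ys) ++ map f (cartesianProductWith h xs ys))
      ≡⟨ sum-++ (map f (map (h x) ys)) _ ⟩
    ∑ (map (h x) ys) f + ∑ (cartesianProductWith h xs ys) f
      ≡⟨ cong₂ _+_ (∑-map (h x) ys f) (∑-cartesian h xs ys f) ⟩
    ∑[ y ← ys ] f (h x y) + ∑[ x ← xs ] ∑[ y ← ys ] f (h x y) ∎
    where open ≡-Reasoning

  ∑-filter : ∀ {P : Pred A p} (P? : Decidable P) xs (f : A → ℕ) →
             ∑ (filter P? xs) f ≡ ∑[ x ← xs ] (𝟙 (P? x) * f x)
  ∑-filter P? []       f = refl
  ∑-filter P? (x ∷ xs) f with does (P? x)
  ... | true  = cong₂ _+_ (sym (+-identityʳ (f x))) (∑-filter P? xs f)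
  ... | false = ∑-filter P? xs f

  length≡∑1 : (xs : List A) → length xs ≡ ∑[ _ ← xs ] 1
  length≡∑1 xs = sym (trans (∑-const xs 1) (*-identityʳ (length xs)))

  length-filter≡∑ : ∀ {P : Pred A p} (P? : Decidable P) xs → length (filter P? xs) ≡ ∑[ x ← xs ] 𝟙 (P? x)
  length-filter≡∑ P? xs = begin
    length (filter P? xs)      ≡⟨ length≡∑1 (filter P? xs) ⟩
    ∑[ _ ← filter P? xs ] 1    ≡⟨ ∑-filter P? xs _ ⟩
    ∑[ x ← xs ] (𝟙 (P? x) * 1) ≡⟨ ∑-cong xs (λ x → *-identityʳ _) ⟩
    ∑[ x ← xs ] 𝟙 (P? x)       ∎
    where open ≡-Reasoning

  ∑-allFin-suc : ∀ {n} (f : Fin (suc n) → ℕ) → ∑ (allFin (suc n)) f ≡ f zero + ∑ (allFin n) (f ∘ suc)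
  ∑-allFin-suc {n} f = cong (f zero +_) (cong sum (trans (Listₚ.map-tabulate suc f) (sym (Listₚ.map-tabulate id (f ∘ suc)))))

  ∑-point : ∀ {n} (j : Fin n) (f : Fin n → ℕ) → ∑[ i ← allFin n ] (𝟙 (i ≟ᶠ j) * f i) ≡ f j
  ∑-point {suc n} zero f = begin
    ∑[ i ← allFin (suc n) ] (𝟙 (i ≟ᶠ zero) * f i) ≡⟨ ∑-allFin-suc (λ i → 𝟙 (i ≟ᶠ zero) * f i) ⟩
    1 * f zero + ∑[ i ← allFin n ] 0
      ≡⟨ cong₂ _+_ (*-identityˡ (f zero)) (trans (∑-const (allFin n) 0) (*-zeroʳ (length (allFin n)))) ⟩
    f zero + 0                                    ≡⟨ +-identityʳ (f zero) ⟩
    f zero                                        ∎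
    where open ≡-Reasoning
  ∑-point {suc n} (suc j) f = begin
    ∑[ i ← allFin (suc n) ] (𝟙 (i ≟ᶠ suc j) * f i)   ≡⟨ ∑-allFin-suc (λ i → 𝟙 (i ≟ᶠ suc j) * f i) ⟩
    ∑[ i ← allFin n ] (𝟙 (suc i ≟ᶠ suc j) * f (suc i))
      ≡⟨ ∑-cong (allFin n) (λ i → cong (_* f (suc i)) (𝟙-cong (suc i ≟ᶠ suc j) (i ≟ᶠ j) (λ { refl → refl }) (cong suc))) ⟩
    ∑[ i ← allFin n ] (𝟙 (i ≟ᶠ j) * f (suc i))       ≡⟨ ∑-point j (f ∘ suc) ⟩
    f (suc j)                                        ∎
    where open ≡-Reasoning

  2mn≤m²+n² : ∀ m n → 2 * (m * n) ≤ m * m + n * n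
  2mn≤m²+n² m n with ≤-total m n
  ... | inj₁ m≤n = ordered m≤n
    where
    open +-*-Solver
    ordered : ∀ {m n} → m ≤ n → 2 * (m * n) ≤ m * m + n * n
    ordered {m} m≤n with k , refl ← m≤n⇒∃[o]m+o≡n m≤n = m+n≤o⇒m≤o _ {k * k} (≤-reflexive
      (solve 2 (λ m k → con 2 :* (m :* (m :+ k)) :+ k :* k := m :* m :+ (m :+ k) :* (m :+ k)) refl m k))
  ... | inj₂ n≤m with k , refl ← m≤n⇒∃[o]m+o≡n n≤m = m+n≤o⇒m≤o _ {k * k} (≤-reflexive
      (solve 2 (λ m k → con 2 :* ((m :+ k) :* m) :+ k :* k := (m :+ k) :* (m :+ k) :+ m :* m) refl n k))
    where open +-*-Solver

  -- Twice the squared sum is the sum of 2 `f x` `f y` over all ordered pairs, and each term is at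
  -- most `f x`² + `f y`²; either square then sums to `length xs` times the sum of squares.
  ∑-cauchySchwarz : ∀ (xs : List A) (f : A → ℕ) → ∑ xs f * ∑ xs f ≤ length xs * ∑[ x ← xs ] (f x * f x)
  ∑-cauchySchwarz xs f = *-cancelˡ-≤ 2 (begin
    2 * (S * S)                                        ≡⟨ cong (2 *_) (∑-*-∑ xs xs f f) ⟩
    2 * ∑[ x ← xs ] ∑[ y ← xs ] (f x * f y)            ≡⟨ ∑-*ˡ xs 2 _ ⟨
    ∑[ x ← xs ] (2 * ∑[ y ← xs ] (f x * f y))          ≡⟨ ∑-cong xs (λ x → ∑-*ˡ xs 2 _) ⟨
    ∑[ x ← xs ] ∑[ y ← xs ] (2 * (f x * f y))
      ≤⟨ ∑-mono xs (λ x → ∑-mono xs λ y → 2mn≤m²+n² (f x) (f y)) ⟩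
    ∑[ x ← xs ] ∑[ y ← xs ] (f x * f x + f y * f y)
      ≡⟨ ∑-cong xs (λ x → trans (∑-+ xs _ _) (cong (_+ T) (∑-const xs _))) ⟩
    ∑[ x ← xs ] (length xs * (f x * f x) + T)          ≡⟨ ∑-+ xs _ _ ⟩
    ∑[ x ← xs ] (length xs * (f x * f x)) + ∑[ _ ← xs ] T
      ≡⟨ cong₂ _+_ (∑-*ˡ xs (length xs) _) (∑-const xs T) ⟩
    length xs * T + length xs * T                      ≡⟨ cong (length xs * T +_) (+-identityʳ _) ⟨
    2 * (length xs * T)                                ∎)
    where
    open ≤-Reasoning
    S T : ℕ
    S = ∑ xs f
    T = ∑[ x ← xs ] (f x * f x)

  -- Consumes two coordinates at a time when what remains depends on them only through `h x y`.
  -- Nested once per difference, it turns counts of 4- and 8-tuples into sums over differences.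
  ∑-tuples-pairs : ∀ {a b} {X : Set a} {B : Set b} (h : X → X → B) (xs : List X) {k} (f : Vec X (suc (suc k)) → ℕ) {g : B → ℕ} →
                   (∀ x y → ∑[ v ← tuples k xs ] f (x ∷ y ∷ v) ≡ g (h x y)) →
                   ∑ (tuples (suc (suc k)) xs) f ≡ ∑ (cartesianProductWith h xs xs) g
  ∑-tuples-pairs h xs {k} f {g} eq = begin
    ∑ (tuples (suc (suc k)) xs) f                          ≡⟨ ∑-cartesian _∷_ xs (tuples (suc k) xs) f ⟩
    ∑[ x ← xs ] ∑[ v ← tuples (suc k) xs ] f (x ∷ v)
      ≡⟨ ∑-cong xs (λ x → ∑-cartesian _∷_ xs (tuples k xs) _) ⟩
    ∑[ x ← xs ] ∑[ y ← xs ] ∑[ v ← tuples k xs ] f (x ∷ y ∷ v) ≡⟨ ∑∑-cong xs xs eq ⟩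
    ∑[ x ← xs ] ∑[ y ← xs ] g (h x y)                      ≡⟨ ∑-cartesian h xs xs g ⟨
    ∑ (cartesianProductWith h xs xs) g                     ∎
    where open ≡-Reasoning

  length-allFin : ∀ n → length (allFin n) ≡ n
  length-allFin n = Listₚ.length-tabulate {n = n} id

  ∑-∈-∷ : ∀ {n} s (p : Subset n) →
          ∑[ i ← allFin n ] 𝟙 (i ∈ᶠ? p) ≡ ∑[ i ← allFin n ] 𝟙 (suc i ∈ᶠ? (s ∷ p))
  ∑-∈-∷ {n} s p = ∑-cong (allFin n) λ i →
    𝟙-cong (i ∈ᶠ? p) (suc i ∈ᶠ? (s ∷ p)) there λ { (there i∈p) → i∈p }

  ∣p∣≡∑ : ∀ {n} (p : Subset n) → ∣ p ∣ ≡ ∑[ i ← allFin n ] 𝟙 (i ∈ᶠ? p)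
  ∣p∣≡∑ []                = refl
  ∣p∣≡∑ (s@inside  ∷ p) = trans (cong suc (trans (∣p∣≡∑ p) (∑-∈-∷ s p)))
    (sym (∑-allFin-suc λ i → 𝟙 (i ∈ᶠ? (s ∷ p))))
  ∣p∣≡∑ (s@outside ∷ p) = trans (trans (∣p∣≡∑ p) (∑-∈-∷ s p))
    (sym (∑-allFin-suc λ i → 𝟙 (i ∈ᶠ? (s ∷ p))))

  x∉p-x : ∀ {n} (p : Subset n) {x} → ¬ (x Subset.∈ (p ∖ x))
  x∉p-x (_ ∷ p) {suc x} (there x∈p-x) = x∉p-x p x∈p-x

  ∣p∣≤1+∣p-x∣ : ∀ {n} (p : Subset n) x → ∣ p ∣ ≤ suc ∣ p ∖ x ∣
  ∣p∣≤1+∣p-x∣ (inside  ∷ p) zero    = s≤s (≤-reflexive (cong ∣_∣ (sym (Subsetₚ.p─⊥≡p p))))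
  ∣p∣≤1+∣p-x∣ (outside ∷ p) zero    = m≤n⇒m≤1+n (≤-reflexive (cong ∣_∣ (sym (Subsetₚ.p─⊥≡p p))))
  ∣p∣≤1+∣p-x∣ (inside  ∷ p) (suc x) = s≤s (∣p∣≤1+∣p-x∣ p x)
  ∣p∣≤1+∣p-x∣ (outside ∷ p) (suc x) = ∣p∣≤1+∣p-x∣ p x

  -- From the two moments of the energy to bounds on the number of rich slopes.

  module Arithmetic
    {I : Set a} (is : List I) (e : I → ℕ) (q n D M : ℕ) .{{_ : NonZero q}} .{{_ : NonZero n}}
    (length≡q : length is ≡ q)
    (∑e  : ∑ is e + n ^ 3 ≡ n ^ 4 + q * n ^ 2)
    (∑e² : ∑[ i ← is ] (e i * e i) + n ^ 6 ≡ D + q * n ^ 4)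
    (n⁴≤qe : ∀ i → n ^ 4 ≤ q * e i)
    (e≤n³ : ∀ i → e i ≤ n ^ 3)
    (M-def : M + n ^ 8 ≡ q * D)
    (12qn⁶≤M : 12 * (q * n ^ 6) ≤ M)
    where

    open +-*-Solver

    -- With K₀ = 3 q² n⁵ / M this says that e i is at least n³ / K₀.
    IsRich : I → Set
    IsRich i = M ≤ 3 * (q * q * n ^ 2) * e i

    isRich? : ∀ i → Dec (IsRich i)
    isRich? i = M ≤? 3 * (q * q * n ^ 2) * e i

    #rich : ℕ
    #rich = ∑[ i ← is ] 𝟙 (isRich? i)

    private
      -- The excess of e over n⁴ / q, times q; by n⁴≤qe nothing is truncated.
      f : I → ℕ
      f i = q * e i ∸ n ^ 4

      f-def : ∀ i → n ^ 4 + f i ≡ q * e i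
      f-def i = m+[n∸m]≡n (n⁴≤qe i)

      ∑-const-q : ∀ c → ∑[ _ ← is ] c ≡ q * c
      ∑-const-q c = trans (∑-const is c) (cong (_* c) length≡q)

      Σf Σf² : ℕ
      Σf  = ∑ is f
      Σf² = ∑[ i ← is ] (f i * f i)

      ∑f : Σf + q * n ^ 3 ≡ q * q * n ^ 2
      ∑f = +-cancelˡ-≡ (q * n ^ 4) _ _ (begin
        q * n ^ 4 + (Σf + q * n ^ 3)    ≡⟨ +-assoc (q * n ^ 4) Σf _ ⟨
        q * n ^ 4 + Σf + q * n ^ 3      ≡⟨ cong (_+ q * n ^ 3) lemma ⟩
        q * ∑ is e + q * n ^ 3          ≡⟨ *-distribˡ-+ q (∑ is e) _ ⟨
        q * (∑ is e + n ^ 3)            ≡⟨ cong (q *_) ∑e ⟩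
        q * (n ^ 4 + q * n ^ 2)
          ≡⟨ solve 2 (λ q n → q :* (n :^ 4 :+ q :* n :^ 2) := q :* n :^ 4 :+ q :* q :* n :^ 2) refl q n ⟩
        q * n ^ 4 + q * q * n ^ 2       ∎)
        where
        open ≡-Reasoning
        lemma : q * n ^ 4 + Σf ≡ q * ∑ is e
        lemma = begin
          q * n ^ 4 + Σf               ≡⟨ cong (_+ Σf) (∑-const-q (n ^ 4)) ⟨
          ∑[ _ ← is ] (n ^ 4) + Σf     ≡⟨ ∑-+ is _ f ⟨
          ∑[ i ← is ] (n ^ 4 + f i)    ≡⟨ ∑-cong is f-def ⟩
          ∑[ i ← is ] (q * e i)        ≡⟨ ∑-*ˡ is q e ⟩
          q * ∑ is e                   ∎

      -- Expand (q e)² = (n⁴ + f)² and sum. Of the 3 q² n⁶, one part is the correction n⁶ in `∑e²`;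
      -- the other two come from the cross term 2 n⁴ Σf once `∑f` evaluates it.
      ∑f² : Σf² + 3 * (q * q * n ^ 6) ≡ q * M + (q * q * q * n ^ 4 + 2 * (q * n ^ 7))
      ∑f² = +-cancelˡ-≡ (q * n ^ 8 + 2 * n ^ 4 * Σf) _ _ (begin
        q * n ^ 8 + 2 * n ^ 4 * Σf + (Σf² + 3 * (q * q * n ^ 6))
          ≡⟨ solve 4 (λ q n F G → q :* n :^ 8 :+ con 2 :* n :^ 4 :* F :+ (G :+ con 3 :* (q :* q :* n :^ 6))
                := q :* n :^ 8 :+ (con 2 :* n :^ 4 :* F :+ G) :+ con 3 :* (q :* q :* n :^ 6)) refl q n Σf Σf² ⟩
        q * n ^ 8 + (2 * n ^ 4 * Σf + Σf²) + 3 * (q * q * n ^ 6)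
          ≡⟨ cong (_+ 3 * (q * q * n ^ 6)) lemma ⟩
        q * q * Σe² + 3 * (q * q * n ^ 6)
          ≡⟨ solve 3 (λ q n G → q :* q :* G :+ con 3 :* (q :* q :* n :^ 6)
                := q :* q :* (G :+ n :^ 6) :+ con 2 :* (q :* q :* n :^ 6)) refl q n Σe² ⟩
        q * q * (Σe² + n ^ 6) + 2 * (q * q * n ^ 6)
          ≡⟨ cong (λ t → q * q * t + 2 * (q * q * n ^ 6)) ∑e² ⟩
        q * q * (D + q * n ^ 4) + 2 * (q * q * n ^ 6)
          ≡⟨ solve 3 (λ q n D → q :* q :* (D :+ q :* n :^ 4) :+ con 2 :* (q :* q :* n :^ 6)
                := q :* (q :* D) :+ q :* q :* q :* n :^ 4 :+ con 2 :* n :^ 4 :* (q :* q :* n :^ 2)) refl q n D ⟩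
        q * (q * D) + q * q * q * n ^ 4 + 2 * n ^ 4 * (q * q * n ^ 2)
          ≡⟨ cong₂ (λ s t → q * s + q * q * q * n ^ 4 + 2 * n ^ 4 * t) M-def ∑f ⟨
        q * (M + n ^ 8) + q * q * q * n ^ 4 + 2 * n ^ 4 * (Σf + q * n ^ 3)
          ≡⟨ solve 4 (λ q n M F → q :* (M :+ n :^ 8) :+ q :* q :* q :* n :^ 4 :+ con 2 :* n :^ 4 :* (F :+ q :* n :^ 3)
                := q :* n :^ 8 :+ con 2 :* n :^ 4 :* F :+ (q :* M :+ (q :* q :* q :* n :^ 4 :+ con 2 :* (q :* n :^ 7)))) refl q n M Σf ⟩
        q * n ^ 8 + 2 * n ^ 4 * Σf + (q * M + (q * q * q * n ^ 4 + 2 * (q * n ^ 7))) ∎)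
        where
        open ≡-Reasoning
        Σe² : ℕ
        Σe² = ∑[ i ← is ] (e i * e i)
        square : ∀ i → n ^ 8 + (2 * n ^ 4 * f i + f i * f i) ≡ q * q * (e i * e i)
        square i = begin
          n ^ 8 + (2 * n ^ 4 * f i + f i * f i)
            ≡⟨ solve 2 (λ n F → n :^ 8 :+ (con 2 :* n :^ 4 :* F :+ F :* F)
                  := (n :^ 4 :+ F) :* (n :^ 4 :+ F)) refl n (f i) ⟩
          (n ^ 4 + f i) * (n ^ 4 + f i)  ≡⟨ cong₂ _*_ (f-def i) (f-def i) ⟩
          q * e i * (q * e i)            ≡⟨ [m*n]*[o*p]≡[m*o]*[n*p] q (e i) q (e i) ⟩
          q * q * (e i * e i)            ∎
        lemma : q * n ^ 8 + (2 * n ^ 4 * Σf + Σf²) ≡ q * q * Σe²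
        lemma = begin
          q * n ^ 8 + (2 * n ^ 4 * Σf + Σf²)
            ≡⟨ cong₂ (λ s t → s + (t + Σf²)) (∑-const-q (n ^ 8)) (∑-*ˡ is (2 * n ^ 4) f) ⟨
          ∑[ _ ← is ] (n ^ 8) + (∑[ i ← is ] (2 * n ^ 4 * f i) + Σf²)
            ≡⟨ cong (∑[ _ ← is ] (n ^ 8) +_) (∑-+ is _ _) ⟨
          ∑[ _ ← is ] (n ^ 8) + ∑[ i ← is ] (2 * n ^ 4 * f i + f i * f i)
            ≡⟨ ∑-+ is _ _ ⟨
          ∑[ i ← is ] (n ^ 8 + (2 * n ^ 4 * f i + f i * f i))
            ≡⟨ ∑-cong is square ⟩
          ∑[ i ← is ] (q * q * (e i * e i))
            ≡⟨ ∑-*ˡ is (q * q) _ ⟩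
          q * q * Σe² ∎

      Σf≤q²n² : Σf ≤ q * q * n ^ 2
      Σf≤q²n² = m+n≤o⇒m≤o Σf (≤-reflexive ∑f)

      -- 12 q n⁶ ≤ M makes the constant n⁴ a small part of q e at a rich point.
      rich⇒M≤4qn²f : ∀ i (rich? : Dec (IsRich i)) → 𝟙 rich? * M ≤ 4 * (q * n ^ 2) * f i
      rich⇒M≤4qn²f i (no _)     = z≤n
      rich⇒M≤4qn²f i (yes rich) = *-cancelˡ-≤ 3 (+-cancelˡ-≤ M _ _ (begin
        M + 3 * (1 * M)
          ≡⟨ solve 1 (λ M → M :+ con 3 :* (con 1 :* M) := con 4 :* M) refl M ⟩
        4 * M                                    ≤⟨ *-monoʳ-≤ 4 rich ⟩
        4 * (3 * (q * q * n ^ 2) * e i)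
          ≡⟨ solve 3 (λ q n x → con 4 :* (con 3 :* (q :* q :* n :^ 2) :* x)
                := con 12 :* (q :* n :^ 2) :* (q :* x)) refl q n (e i) ⟩
        12 * (q * n ^ 2) * (q * e i)             ≡⟨ cong (12 * (q * n ^ 2) *_) (f-def i) ⟨
        12 * (q * n ^ 2) * (n ^ 4 + f i)
          ≡⟨ solve 3 (λ q n x → con 12 :* (q :* n :^ 2) :* (n :^ 4 :+ x)
                := con 12 :* (q :* n :^ 6) :+ con 3 :* (con 4 :* (q :* n :^ 2) :* x)) refl q n (f i) ⟩
        12 * (q * n ^ 6) + 3 * (4 * (q * n ^ 2) * f i) ≤⟨ +-monoˡ-≤ _ 12qn⁶≤M ⟩
        M + 3 * (4 * (q * n ^ 2) * f i)          ∎))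
        where open ≤-Reasoning

      -- At a poor index one factor f ≤ q e lies below M / (3 q n²), which leaves a term linear in
      -- f, to be summed by `Σf≤q²n²`. At a rich index the trivial bound e ≤ n³ is used for both
      -- factors.
      f²≤ : ∀ i (rich? : Dec (IsRich i)) →
           3 * (q * n ^ 2) * (f i * f i) ≤ M * f i + 𝟙 rich? * (3 * (q * n ^ 2) * (q * q * n ^ 6))
      f²≤ i (no poor) = ≤-trans (begin
        3 * (q * n ^ 2) * (f i * f i)     ≤⟨ *-monoʳ-≤ (3 * (q * n ^ 2)) (*-monoˡ-≤ (f i) f≤qe) ⟩
        3 * (q * n ^ 2) * (q * e i * f i)
          ≡⟨ solve 4 (λ q n x y → con 3 :* (q :* n :^ 2) :* (q :* x :* y)
                := con 3 :* (q :* q :* n :^ 2) :* x :* y) refl q n (e i) (f i) ⟩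
        3 * (q * q * n ^ 2) * e i * f i   ≤⟨ *-monoˡ-≤ (f i) (<⇒≤ (≰⇒> poor)) ⟩
        M * f i                           ∎) (m≤m+n (M * f i) _)
        where
        open ≤-Reasoning
        f≤qe : f i ≤ q * e i
        f≤qe = m+n≤o⇒n≤o (n ^ 4) (≤-reflexive (f-def i))
      f²≤ i (yes _)   = begin
        3 * (q * n ^ 2) * (f i * f i)     ≤⟨ *-monoʳ-≤ (3 * (q * n ^ 2)) (*-mono-≤ f≤qn³ f≤qn³) ⟩
        3 * (q * n ^ 2) * (q * n ^ 3 * (q * n ^ 3))
          ≡⟨ solve 2 (λ q n → con 3 :* (q :* n :^ 2) :* (q :* n :^ 3 :* (q :* n :^ 3))
                := con 1 :* (con 3 :* (q :* n :^ 2) :* (q :* q :* n :^ 6))) refl q n ⟩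
        1 * (3 * (q * n ^ 2) * (q * q * n ^ 6)) ≤⟨ m≤n+m _ (M * f i) ⟩
        M * f i + 1 * (3 * (q * n ^ 2) * (q * q * n ^ 6)) ∎
        where
        open ≤-Reasoning
        f≤qn³ : f i ≤ q * n ^ 3
        f≤qn³ = ≤-trans (m+n≤o⇒n≤o (n ^ 4) (≤-reflexive (f-def i))) (*-monoʳ-≤ q (e≤n³ i))

      instance
        qn²≢0 : NonZero (q * n ^ 2)
        qn²≢0 = m*n≢0 q (n ^ 2) {{it}} {{m^n≢0 n 2}}

      -- The linear terms add up to only one q M, whereas `qM≤` puts 3 Σf² near 3 q M or above; the
      -- gap must come from rich indices.
      3Σf²≤ : 3 * Σf² ≤ q * M + 3 * (q * q * n ^ 6) * #rich
      3Σf²≤ = *-cancelˡ-≤ (q * n ^ 2) (begin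
        q * n ^ 2 * (3 * Σf²)
          ≡⟨ solve 2 (λ c x → c :* (con 3 :* x) := con 3 :* c :* x) refl (q * n ^ 2) Σf² ⟩
        3 * (q * n ^ 2) * Σf²    ≡⟨ ∑-*ˡ is (3 * (q * n ^ 2)) _ ⟨
        ∑[ i ← is ] (3 * (q * n ^ 2) * (f i * f i)) ≤⟨ ∑-mono is (λ i → f²≤ i (isRich? i)) ⟩
        ∑[ i ← is ] (M * f i + 𝟙 (isRich? i) * (3 * (q * n ^ 2) * (q * q * n ^ 6)))
          ≡⟨ trans (∑-+ is _ _) (cong₂ _+_ (∑-*ˡ is M f) (∑-*ʳ is (λ i → 𝟙 (isRich? i)) _)) ⟩
        M * Σf + #rich * (3 * (q * n ^ 2) * (q * q * n ^ 6)) ≤⟨ +-monoˡ-≤ _ (*-monoʳ-≤ M Σf≤q²n²) ⟩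
        M * (q * q * n ^ 2) + #rich * (3 * (q * n ^ 2) * (q * q * n ^ 6))
          ≡⟨ solve 4 (λ q n M r → M :* (q :* q :* n :^ 2) :+ r :* (con 3 :* (q :* n :^ 2) :* (q :* q :* n :^ 6))
                := q :* n :^ 2 :* (q :* M :+ con 3 :* (q :* q :* n :^ 6) :* r)) refl q n M #rich ⟩
        q * n ^ 2 * (q * M + 3 * (q * q * n ^ 6) * #rich) ∎)
        where open ≤-Reasoning

      -- The identity `∑f²` with its lower-order positive terms q³ n⁴ and 2 q n⁷ dropped.
      qM≤ : q * M ≤ Σf² + 3 * (q * q * n ^ 6)
      qM≤ = m+n≤o⇒m≤o (q * M) (≤-reflexive (sym ∑f²))

    -- Markov's inequality for f with threshold M / (4 q n²).
    #rich-upper : #rich * M ≤ 4 * (q * q * q * n ^ 4)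
    #rich-upper = begin
      #rich * M                             ≡⟨ ∑-*ʳ is _ M ⟨
      ∑[ i ← is ] (𝟙 (isRich? i) * M)       ≤⟨ ∑-mono is (λ i → rich⇒M≤4qn²f i (isRich? i)) ⟩
      ∑[ i ← is ] (4 * (q * n ^ 2) * f i)   ≡⟨ ∑-*ˡ is (4 * (q * n ^ 2)) f ⟩
      4 * (q * n ^ 2) * Σf                  ≤⟨ *-monoʳ-≤ (4 * (q * n ^ 2)) Σf≤q²n² ⟩
      4 * (q * n ^ 2) * (q * q * n ^ 2)
        ≡⟨ solve 2 (λ q n → con 4 :* (q :* n :^ 2) :* (q :* q :* n :^ 2)
              := con 4 :* (q :* q :* q :* n :^ 4)) refl q n ⟩
      4 * (q * q * q * n ^ 4)               ∎
      where open ≤-Reasoning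

    -- Here `r` counts what is left after one rich index, the slope 0, has been discarded. Comparing
    -- three times `qM≤` with `3Σf²≤` produces the error 9 `T`, and the discarded index adds 3 `T`.
    -- Together these are q · 12 q n⁶, at most a second q M, so one of the three copies of q M
    -- survives.
    #rich-lower : ∀ r → #rich ≤ suc r → M ≤ 3 * (q * n ^ 6) * r
    #rich-lower r #rich≤1+r = *-cancelˡ-≤ q (+-cancelˡ-≤ (2 * (q * M)) _ _ (begin
      2 * (q * M) + q * M        ≡⟨ solve 1 (λ x → con 2 :* x :+ x := con 3 :* x) refl (q * M) ⟩
      3 * (q * M)                ≤⟨ *-monoʳ-≤ 3 qM≤ ⟩
      3 * (Σf² + 3 * T)
        ≡⟨ solve 2 (λ x t → con 3 :* (x :+ con 3 :* t) := con 3 :* x :+ con 9 :* t) refl Σf² T ⟩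
      3 * Σf² + 9 * T            ≤⟨ +-monoˡ-≤ (9 * T) 3Σf²≤ ⟩
      q * M + 3 * T * #rich + 9 * T
        ≤⟨ +-monoˡ-≤ (9 * T) (+-monoʳ-≤ (q * M) (*-monoʳ-≤ (3 * T) #rich≤1+r)) ⟩
      q * M + 3 * T * suc r + 9 * T    ≡⟨ solve 4 (λ q M n r → let t = q :* q :* n :^ 6 in
                                             q :* M :+ con 3 :* t :* (con 1 :+ r) :+ con 9 :* t
              := q :* M :+ q :* (con 12 :* (q :* n :^ 6)) :+ q :* (con 3 :* (q :* n :^ 6) :* r)) refl q M n r ⟩
      q * M + q * (12 * (q * n ^ 6)) + q * (3 * (q * n ^ 6) * r)
        ≤⟨ +-monoˡ-≤ _ (+-monoʳ-≤ (q * M) (*-monoʳ-≤ q 12qn⁶≤M)) ⟩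
      q * M + q * M + q * (3 * (q * n ^ 6) * r)
        ≡⟨ cong (λ t → q * M + t + q * (3 * (q * n ^ 6) * r)) (+-identityʳ (q * M)) ⟨
      2 * (q * M) + q * (3 * (q * n ^ 6) * r) ∎))
      where
      open ≤-Reasoning
      T : ℕ
      T = q * q * n ^ 6

  -- Counting slopes and collisions in a finite field.

  module FieldCounting {c ℓ₁ ℓ₂ q} (F : FiniteField c ℓ₁ ℓ₂ q) where

    private
      module F = FiniteField F
      fieldRing : CommutativeRing c ℓ₁
      fieldRing = HeytingCommutativeRing.commutativeRing F.heytingCommutativeRing
    open F using (Carrier; _≈_; _≟_; index; element; 0#; 1#)
      renaming (_+_ to _+ᶠ_; _*_ to _*ᶠ_; _-_ to _-ᶠ_)

    element-index : ∀ x → element (index x) ≈ x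
    element-index = Inverse.strictlyInverseʳ F.enumeration

    index-element : ∀ i → index (element i) ≡ i
    index-element = Inverse.strictlyInverseˡ F.enumeration

    index-cong : ∀ {x y} → x ≈ y → index x ≡ index y
    index-cong = Inverse.to-cong F.enumeration

    -- An inverse is searched for in the enumeration. If none exists, `x` cannot be apart from `0#`,
    -- and tightness of the apartness gives `x ≈ 0#`.
    zero⊎unit : ∀ x → x ≈ 0# ⊎ ∃[ u ] x *ᶠ u ≈ 1#
    zero⊎unit x with Finₚ.any? (λ i → x *ᶠ element i ≟ 1#)
    ... | yes (i , xu≈1) = inj₂ (element i , xu≈1)
    ... | no ¬unit       = inj₁ (proj₁ (F.tight x 0#) λ x#0 →
      let u , _ , [x-0]u≈1 = F.#⇒invertible x#0 in
      ¬unit (index u , (begin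
        x *ᶠ element (index u)
          ≈⟨ F.*-cong (F.sym (HeytingProperties.x-0≈x F.heytingCommutativeRing x)) (element-index u) ⟩
        (x -ᶠ 0#) *ᶠ u          ≈⟨ [x-0]u≈1 ⟩
        1#                      ∎)))
      where open SetoidReasoning F.setoid

    𝟙-≟-resp : ∀ {x x′ y y′} → x ≈ x′ → y ≈ y′ → 𝟙 (x ≟ y) ≡ 𝟙 (x′ ≟ y′)
    𝟙-≟-resp {x} {x′} {y} {y′} x≈x′ y≈y′ = 𝟙-cong (x ≟ y) (x′ ≟ y′)
      (λ x≈y → F.trans (F.sym x≈x′) (F.trans x≈y y≈y′))
      (λ x≈y → F.trans x≈x′ (F.trans x≈y (F.sym y≈y′)))

    𝟙-≟-element : ∀ x i → 𝟙 (x ≟ element i) ≡ 𝟙 (i ≟ᶠ index x)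
    𝟙-≟-element x i = 𝟙-cong (x ≟ element i) (i ≟ᶠ index x)
      (λ x≈i → trans (sym (index-element i)) (sym (index-cong x≈i)))
      (λ { refl → F.sym (element-index x) })

    ∑-unique : ∀ x (f : Fin q → ℕ) → ∑[ i ← allFin q ] (𝟙 (x ≟ element i) * f i) ≡ f (index x)
    ∑-unique x f = trans (∑-cong (allFin q) λ i → cong (_* f i) (𝟙-≟-element x i)) (∑-point (index x) f)

    ∑-𝟙-≟-element : ∀ x → ∑[ i ← allFin q ] 𝟙 (x ≟ element i) ≡ 1
    ∑-𝟙-≟-element x = trans (∑-cong (allFin q) λ i → sym (*-identityʳ _)) (∑-unique x (λ _ → 1))

    [_,_]≈0 : Carrier → Carrier → ℕ
    [ x , y ]≈0 = 𝟙 (x ≟ 0#) * 𝟙 (y ≟ 0#)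

    ratios : Carrier → Carrier → Carrier → Carrier → ℕ
    ratios x z w y = ∑[ i ← allFin q ] (𝟙 (x ≟ element i *ᶠ z) * 𝟙 (w ≟ element i *ᶠ y))

    private
      -- The first equation forces the slope x u, so the sum collapses to a single term; multiplying
      -- its condition w = x u y by the unit z gives x y = z w.
      ratios-unit : ∀ x {z u} w y → z *ᶠ u ≈ 1# → ratios x z w y ≡ 𝟙 (x *ᶠ y ≟ z *ᶠ w)
      ratios-unit x {z} {u} w y zu≈1 = begin
        ratios x z w y
          ≡⟨ ∑-cong (allFin q) (λ i → cong (_* 𝟙 (w ≟ element i *ᶠ y)) (solve-ratio (element i))) ⟩
        ∑[ i ← allFin q ] (𝟙 (x *ᶠ u ≟ element i) * 𝟙 (w ≟ element i *ᶠ y))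
          ≡⟨ ∑-unique (x *ᶠ u) (λ i → 𝟙 (w ≟ element i *ᶠ y)) ⟩
        𝟙 (w ≟ element (index (x *ᶠ u)) *ᶠ y)
          ≡⟨ 𝟙-≟-resp F.refl (F.*-congʳ (element-index (x *ᶠ u))) ⟩
        𝟙 (w ≟ x *ᶠ u *ᶠ y)
          ≡⟨ 𝟙-cong (w ≟ x *ᶠ u *ᶠ y) (x *ᶠ y ≟ z *ᶠ w) to from ⟩
        𝟙 (x *ᶠ y ≟ z *ᶠ w) ∎
        where
        open ≡-Reasoning
        open CommutativeSemigroupProperties (CommutativeRing.*-commutativeSemigroup fieldRing)
        z[ut]≈t : ∀ t → z *ᶠ (u *ᶠ t) ≈ t
        z[ut]≈t t = F.trans (F.sym (F.*-assoc z u t)) (F.trans (F.*-congʳ zu≈1) (F.*-identityˡ t))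
        z[xuy]≈xy : z *ᶠ (x *ᶠ u *ᶠ y) ≈ x *ᶠ y
        z[xuy]≈xy = F.trans (F.*-congˡ (xy∙z≈y∙xz x u y)) (z[ut]≈t (x *ᶠ y))
        to : w ≈ x *ᶠ u *ᶠ y → x *ᶠ y ≈ z *ᶠ w
        to w≈ = F.sym (F.trans (F.*-congˡ w≈) z[xuy]≈xy)
        from : x *ᶠ y ≈ z *ᶠ w → w ≈ x *ᶠ u *ᶠ y
        from xy≈zw = F.trans (F.sym (z[ut]≈t w)) (F.trans (x∙yz≈y∙xz z u w)
          (F.trans (F.*-congˡ (F.sym xy≈zw)) (x∙yz≈yx∙z u x y)))
        solve-ratio : ∀ t → 𝟙 (x ≟ t *ᶠ z) ≡ 𝟙 (x *ᶠ u ≟ t)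
        solve-ratio t = 𝟙-cong (x ≟ t *ᶠ z) (x *ᶠ u ≟ t)
          (λ x≈tz → F.trans (F.*-congʳ x≈tz) (F.trans (F.*-assoc t z u) (F.trans (F.*-congˡ zu≈1) (F.*-identityʳ t))))
          (λ xu≈t → F.sym (F.trans (F.*-congʳ (F.sym xu≈t)) (F.trans (xy∙z≈x∙zy x u z) (F.trans (F.*-congˡ zu≈1) (F.*-identityʳ x)))))

      unit⇒≉0 : ∀ {z u} → z *ᶠ u ≈ 1# → ¬ (z ≈ 0#)
      unit⇒≉0 {z} {u} zu≈1 z≈0 = proj₂ (F.tight 1# 0#) (F.trans (F.sym zu≈1) (F.trans (F.*-congʳ z≈0) (F.zeroˡ u)))
        (HeytingProperties.1#0 F.heytingCommutativeRing)

    -- The left side counts the points (s : t) of the projective line with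
    -- t x = s z and t w = s y: all q + 1 points if (x , z) and (w , y) both vanish,
    -- otherwise one if they are proportional and none if they are not.
    common-ratio : ∀ x z w y →
      ratios x z w y + 𝟙 (z ≟ 0#) * 𝟙 (y ≟ 0#) ≡ 𝟙 (x *ᶠ y ≟ z *ᶠ w) + q * ([ x , z ]≈0 * [ w , y ]≈0)
    common-ratio x z w y with zero⊎unit z | zero⊎unit y
    ... | inj₂ (u , zu≈1) | _
      rewrite 𝟙-false (z ≟ 0#) (unit⇒≉0 zu≈1) | *-zeroʳ (𝟙 (x ≟ 0#)) | *-zeroʳ q =
      cong (_+ 0) (ratios-unit x w y zu≈1)
    ... | inj₁ z≈0 | inj₂ (u , yu≈1)
      rewrite 𝟙-false (y ≟ 0#) (unit⇒≉0 yu≈1) | *-zeroʳ (𝟙 (z ≟ 0#)) | *-zeroʳ (𝟙 (w ≟ 0#))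
            | *-zeroʳ ([ x , z ]≈0) | *-zeroʳ q =
      cong (_+ 0) (trans (∑-cong (allFin q) λ i → *-comm (𝟙 (x ≟ element i *ᶠ z)) _)
        (trans (ratios-unit w x z yu≈1) (𝟙-cong (w *ᶠ z ≟ y *ᶠ x) (x *ᶠ y ≟ z *ᶠ w)
          (λ wz≈yx → F.trans (F.*-comm x y) (F.trans (F.sym wz≈yx) (F.*-comm w z)))
          (λ xy≈zw → F.trans (F.*-comm w z) (F.trans (F.sym xy≈zw) (F.*-comm x y))))))
    ... | inj₁ z≈0 | inj₁ y≈0
      rewrite 𝟙-true (z ≟ 0#) z≈0 | 𝟙-true (y ≟ 0#) y≈0
            | 𝟙-true (x *ᶠ y ≟ z *ᶠ w) (F.trans (F.*-congˡ y≈0) (F.trans (F.zeroʳ x)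
                (F.sym (F.trans (F.*-congʳ z≈0) (F.zeroˡ w)))))
            | *-identityʳ (𝟙 (x ≟ 0#)) | *-identityʳ (𝟙 (w ≟ 0#)) =
      trans (+-comm _ 1) (cong suc (begin
        ∑[ i ← allFin q ] (𝟙 (x ≟ element i *ᶠ z) * 𝟙 (w ≟ element i *ᶠ y))
          ≡⟨ ∑-cong (allFin q) (λ i → cong₂ _*_ (𝟙-≟-resp F.refl (t*0 (element i) z≈0)) (𝟙-≟-resp F.refl (t*0 (element i) y≈0))) ⟩
        ∑[ _ ← allFin q ] (𝟙 (x ≟ 0#) * 𝟙 (w ≟ 0#))
          ≡⟨ ∑-const (allFin q) _ ⟩
        length (allFin q) * (𝟙 (x ≟ 0#) * 𝟙 (w ≟ 0#))
          ≡⟨ cong (_* (𝟙 (x ≟ 0#) * 𝟙 (w ≟ 0#))) (length-allFin q) ⟩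
        q * (𝟙 (x ≟ 0#) * 𝟙 (w ≟ 0#)) ∎))
      where
      open ≡-Reasoning
      t*0 : ∀ t {s} → s ≈ 0# → t *ᶠ s ≈ 0#
      t*0 t s≈0 = F.trans (F.*-congˡ s≈0) (F.zeroʳ t)

    -- The case w = y = 0 of `common-ratio`: the zero pair lies on every slope, so it imposes no
    -- condition and only the pair (x , z) is counted.
    single-ratio : ∀ x z →
      ∑[ i ← allFin q ] 𝟙 (x ≟ element i *ᶠ z) + 𝟙 (z ≟ 0#) ≡ 1 + q * [ x , z ]≈0
    single-ratio x z = begin
      ∑[ i ← allFin q ] 𝟙 (x ≟ element i *ᶠ z) + 𝟙 (z ≟ 0#)
        ≡⟨ cong₂ _+_ (∑-cong (allFin q) (λ i → times-1 (𝟙 (x ≟ element i *ᶠ z)) (0# ≟ element i *ᶠ 0#) (F.sym (F.zeroʳ _))))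
                     (times-1 _ (0# ≟ 0#) F.refl) ⟩
      ∑[ i ← allFin q ] (𝟙 (x ≟ element i *ᶠ z) * 𝟙 (0# ≟ element i *ᶠ 0#)) + 𝟙 (z ≟ 0#) * 𝟙 (0# ≟ 0#)
        ≡⟨ common-ratio x z 0# 0# ⟩
      𝟙 (x *ᶠ 0# ≟ z *ᶠ 0#) + q * ([ x , z ]≈0 * [ 0# , 0# ]≈0)
        ≡⟨ cong₂ (λ s t → s + q * ([ x , z ]≈0 * t)) (𝟙-true (x *ᶠ 0# ≟ z *ᶠ 0#) (F.trans (F.zeroʳ x) (F.sym (F.zeroʳ z))))
                           (trans (𝟙-idem (0# ≟ 0#)) (𝟙-true (0# ≟ 0#) F.refl)) ⟩
      1 + q * ([ x , z ]≈0 * 1)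
        ≡⟨ cong (λ t → 1 + q * t) (*-identityʳ [ x , z ]≈0) ⟩
      1 + q * [ x , z ]≈0 ∎
      where
      open ≡-Reasoning
      times-1 : ∀ m {P : Set ℓ₁} (P? : Dec P) → P → m ≡ m * 𝟙 P?
      times-1 m P? P = sym (trans (cong (m *_) (𝟙-true P? P)) (*-identityʳ m))

    -- Cauchy-Schwarz for the multiplicities `r i` of the q field elements in `vs`: they sum to the
    -- length, and their squares sum to the number of coinciding pairs.
    ∑∑-collisions : ∀ (vs : List Carrier) → length vs * length vs ≤ q * ∑[ u ← vs ] ∑[ v ← vs ] 𝟙 (u ≟ v)
    ∑∑-collisions vs = begin
      length vs * length vs            ≡⟨ cong (λ t → t * t) length-vs ⟩
      ∑ (allFin q) r * ∑ (allFin q) r  ≤⟨ ∑-cauchySchwarz (allFin q) r ⟩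
      length (allFin q) * ∑[ i ← allFin q ] (r i * r i)
        ≡⟨ cong₂ _*_ (length-allFin q) (∑-cong (allFin q) λ i → ∑-*-∑ vs vs _ _) ⟩
      q * ∑[ i ← allFin q ] ∑[ u ← vs ] ∑[ v ← vs ] (𝟙 (u ≟ element i) * 𝟙 (v ≟ element i))
        ≡⟨ cong (q *_) (∑-swap (allFin q) vs _) ⟩
      q * ∑[ u ← vs ] ∑[ i ← allFin q ] ∑[ v ← vs ] (𝟙 (u ≟ element i) * 𝟙 (v ≟ element i))
        ≡⟨ cong (q *_) (∑-cong vs λ u → ∑-swap (allFin q) vs _) ⟩
      q * ∑[ u ← vs ] ∑[ v ← vs ] ∑[ i ← allFin q ] (𝟙 (u ≟ element i) * 𝟙 (v ≟ element i))
        ≡⟨ cong (q *_) (∑∑-cong vs vs λ u v → trans (∑-unique u (λ i → 𝟙 (v ≟ element i))) (meet u v)) ⟩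
      q * ∑[ u ← vs ] ∑[ v ← vs ] 𝟙 (u ≟ v) ∎
      where
      open ≤-Reasoning
      r : Fin q → ℕ
      r i = ∑[ v ← vs ] 𝟙 (v ≟ element i)
      length-vs : length vs ≡ ∑ (allFin q) r
      length-vs = trans (length≡∑1 vs) (trans (∑-cong vs λ v → sym (∑-𝟙-≟-element v)) (∑-swap vs (allFin q) _))
      meet : ∀ u v → 𝟙 (v ≟ element (index u)) ≡ 𝟙 (u ≟ v)
      meet u v = 𝟙-cong (v ≟ element (index u)) (u ≟ v)
        (λ v≈u → F.trans (F.sym (element-index u)) (F.sym v≈u))
        (λ u≈v → F.trans (F.sym u≈v) (F.sym (element-index u)))

    x-y≈z⇔x≈z+y : ∀ x y z → (x -ᶠ y ≈ z → x ≈ z +ᶠ y) × (x ≈ z +ᶠ y → x -ᶠ y ≈ z)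
    x-y≈z⇔x≈z+y x y z =
      (λ x-y≈z → F.trans (F.sym (//-rightDividesˡ y x)) (F.+-congʳ x-y≈z)) ,
      (λ x≈z+y → F.trans (F.+-congʳ x≈z+y) (//-rightDividesʳ y z))
      where open GroupProperties (CommutativeRing.+-group fieldRing)

    difference-swap : ∀ ξ x y z w → 𝟙 (x -ᶠ y ≟ ξ *ᶠ (z -ᶠ w)) ≡ 𝟙 (x +ᶠ ξ *ᶠ w ≟ y +ᶠ ξ *ᶠ z)
    difference-swap ξ x y z w = 𝟙-cong (x -ᶠ y ≟ ξ *ᶠ (z -ᶠ w)) (x +ᶠ ξ *ᶠ w ≟ y +ᶠ ξ *ᶠ z)
      (λ eq → begin
        x +ᶠ ξ *ᶠ w                        ≈⟨ F.+-congʳ (proj₁ (x-y≈z⇔x≈z+y x y _) eq) ⟩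
        ξ *ᶠ (z -ᶠ w) +ᶠ y +ᶠ ξ *ᶠ w       ≈⟨ xy∙z≈y∙xz _ y _ ⟩
        y +ᶠ (ξ *ᶠ (z -ᶠ w) +ᶠ ξ *ᶠ w)     ≈⟨ F.+-congˡ ξ[z-w]+ξw≈ξz ⟩
        y +ᶠ ξ *ᶠ z                        ∎)
      (λ eq → proj₂ (x-y≈z⇔x≈z+y x y _) (begin
        x                                  ≈⟨ //-rightDividesʳ (ξ *ᶠ w) x ⟨
        x +ᶠ ξ *ᶠ w -ᶠ ξ *ᶠ w              ≈⟨ F.+-congʳ eq ⟩
        y +ᶠ ξ *ᶠ z -ᶠ ξ *ᶠ w              ≈⟨ F.+-congʳ (F.+-congˡ ξ[z-w]+ξw≈ξz) ⟨
        y +ᶠ (ξ *ᶠ (z -ᶠ w) +ᶠ ξ *ᶠ w) -ᶠ ξ *ᶠ w ≈⟨ F.+-congʳ (xy∙z≈y∙xz _ y _) ⟨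
        ξ *ᶠ (z -ᶠ w) +ᶠ y +ᶠ ξ *ᶠ w -ᶠ ξ *ᶠ w   ≈⟨ //-rightDividesʳ (ξ *ᶠ w) _ ⟩
        ξ *ᶠ (z -ᶠ w) +ᶠ y                 ∎))
      where
      open SetoidReasoning F.setoid
      open GroupProperties (CommutativeRing.+-group fieldRing)
      open CommutativeSemigroupProperties (CommutativeRing.+-commutativeSemigroup fieldRing)
      ξ[z-w]+ξw≈ξz : ξ *ᶠ (z -ᶠ w) +ᶠ ξ *ᶠ w ≈ ξ *ᶠ z
      ξ[z-w]+ξw≈ξz = F.trans (F.sym (F.distribˡ ξ _ w)) (F.*-congˡ (//-rightDividesˡ w z))

    -- First and second moments of the energy, and its pointwise bounds.

    module Energy (A : Subset q) where

      private module FS = FieldSubsets F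
      open FS using (elements; E; D×; energyEquation?; productEquation?)

      private
        xs : List Carrier
        xs = elements A

        n : ℕ
        n = ∣ A ∣

        Δ : List Carrier
        Δ = cartesianProductWith _-ᶠ_ xs xs

        Δ² : List (Carrier × Carrier)
        Δ² = cartesianProductWith _,_ Δ Δ

      ∑-elements : ∀ f → ∑ xs f ≡ ∑[ i ← allFin q ] (𝟙 (i ∈ᶠ? A) * f (element i))
      ∑-elements f = trans (∑-map element (filter (_∈ᶠ? A) (allFin q)) f) (∑-filter (_∈ᶠ? A) (allFin q) (f ∘ element))

      length-elements : length xs ≡ n
      length-elements = begin
        length xs                              ≡⟨ length≡∑1 xs ⟩
        ∑[ _ ← xs ] 1                          ≡⟨ ∑-elements (λ _ → 1) ⟩
        ∑[ i ← allFin q ] (𝟙 (i ∈ᶠ? A) * 1)    ≡⟨ ∑-cong (allFin q) (λ i → *-identityʳ _) ⟩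
        ∑[ i ← allFin q ] 𝟙 (i ∈ᶠ? A)          ≡⟨ ∣p∣≡∑ A ⟨
        n                                      ∎
        where open ≡-Reasoning

      ∑-const-elements : ∀ m → ∑[ _ ← xs ] m ≡ n * m
      ∑-const-elements m = trans (∑-const xs m) (cong (_* m) length-elements)

      ∑-membership : ∀ x → ∑[ y ← xs ] 𝟙 (x ≟ y) ≡ 𝟙 (index x ∈ᶠ? A)
      ∑-membership x = begin
        ∑[ y ← xs ] 𝟙 (x ≟ y)                                     ≡⟨ ∑-elements _ ⟩
        ∑[ i ← allFin q ] (𝟙 (i ∈ᶠ? A) * 𝟙 (x ≟ element i))
          ≡⟨ ∑-cong (allFin q) (λ i → *-comm (𝟙 (i ∈ᶠ? A)) _) ⟩
        ∑[ i ← allFin q ] (𝟙 (x ≟ element i) * 𝟙 (i ∈ᶠ? A))       ≡⟨ ∑-unique x _ ⟩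
        𝟙 (index x ∈ᶠ? A)                                         ∎
        where open ≡-Reasoning

      ∑-Δ : ∀ f → ∑ Δ f ≡ ∑[ x ← xs ] ∑[ y ← xs ] f (x -ᶠ y)
      ∑-Δ = ∑-cartesian _-ᶠ_ xs xs

      ∑-const-Δ : ∀ m → ∑[ _ ← Δ ] m ≡ n ^ 2 * m
      ∑-const-Δ m = begin
        ∑[ _ ← Δ ] m              ≡⟨ ∑-Δ (λ _ → m) ⟩
        ∑[ _ ← xs ] ∑[ _ ← xs ] m ≡⟨ ∑-const-elements _ ⟩
        n * (∑[ _ ← xs ] m)       ≡⟨ cong (n *_) (∑-const-elements m) ⟩
        n * (n * m)               ≡⟨ solve 2 (λ n m → n :* (n :* m) := n :^ 2 :* m) refl n m ⟩
        n ^ 2 * m                 ∎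
        where
        open ≡-Reasoning
        open +-*-Solver

      ∑-zeros-Δ : ∑[ x ← Δ ] 𝟙 (x ≟ 0#) ≡ n
      ∑-zeros-Δ = begin
        ∑[ x ← Δ ] 𝟙 (x ≟ 0#)                      ≡⟨ ∑-Δ _ ⟩
        ∑[ x ← xs ] ∑[ y ← xs ] 𝟙 (x -ᶠ y ≟ 0#)
          ≡⟨ ∑∑-cong xs xs (λ x y → 𝟙-cong (x -ᶠ y ≟ 0#) (x ≟ y) (x∙y⁻¹≈ε⇒x≈y x y) x≈y⇒x∙y⁻¹≈ε) ⟩
        ∑[ x ← xs ] ∑[ y ← xs ] 𝟙 (x ≟ y)          ≡⟨ ∑-cong xs ∑-membership ⟩
        ∑[ x ← xs ] 𝟙 (index x ∈ᶠ? A)              ≡⟨ ∑-elements _ ⟩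
        ∑[ i ← allFin q ] (𝟙 (i ∈ᶠ? A) * 𝟙 (index (element i) ∈ᶠ? A))
          ≡⟨ ∑-cong (allFin q) (λ i → trans (cong (λ j → 𝟙 (i ∈ᶠ? A) * 𝟙 (j ∈ᶠ? A)) (index-element i)) (𝟙-idem (i ∈ᶠ? A))) ⟩
        ∑[ i ← allFin q ] 𝟙 (i ∈ᶠ? A)              ≡⟨ ∣p∣≡∑ A ⟨
        n                                          ∎
        where
        open ≡-Reasoning
        open GroupProperties (CommutativeRing.+-group fieldRing)

      ∑-Δ² : ∀ f → ∑ Δ² f ≡ ∑[ x ← Δ ] ∑[ z ← Δ ] f (x , z)
      ∑-Δ² = ∑-cartesian _,_ Δ Δ

      E≡∑ : ∀ ξ → E A ξ ≡ ∑[ (x , z) ← Δ² ] 𝟙 (x ≟ ξ *ᶠ z)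
      E≡∑ ξ = trans (length-filter≡∑ (energyEquation? ξ) (tuples 4 xs))
        (trans (∑-tuples-pairs _-ᶠ_ xs _ λ a₁ a₂ → ∑-tuples-pairs _-ᶠ_ xs _ λ a₃ a₄ → +-identityʳ _)
               (sym (∑-Δ² _)))

      -- The product equation is the cleared form of the proportion x : z = w : y. The sums are
      -- therefore regrouped so that each pair takes one factor from either side and carries one
      -- slope, as in the square of an energy.
      D×≡∑ : D× A ≡ ∑[ (x , z) ← Δ² ] ∑[ (w , y) ← Δ² ] 𝟙 (x *ᶠ y ≟ z *ᶠ w)
      D×≡∑ = begin
        D× A
          ≡⟨ length-filter≡∑ productEquation? (tuples 8 xs) ⟩
        ∑[ v ← tuples 8 xs ] 𝟙 (productEquation? v)
          ≡⟨ (∑-tuples-pairs _-ᶠ_ xs _ λ a₁ a₂ → ∑-tuples-pairs _-ᶠ_ xs _ λ a₃ a₄ →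
              ∑-tuples-pairs _-ᶠ_ xs _ λ a₅ a₆ → ∑-tuples-pairs _-ᶠ_ xs _ λ a₇ a₈ → +-identityʳ _) ⟩
        ∑[ x ← Δ ] ∑[ y ← Δ ] ∑[ z ← Δ ] ∑[ w ← Δ ] 𝟙 (x *ᶠ y ≟ z *ᶠ w)
          ≡⟨ ∑-cong Δ (λ x → trans (∑-swap Δ Δ _) (∑-cong Δ λ z → trans (∑-swap Δ Δ _) (sym (∑-Δ² _)))) ⟩
        ∑[ x ← Δ ] ∑[ z ← Δ ] ∑[ (w , y) ← Δ² ] 𝟙 (x *ᶠ y ≟ z *ᶠ w)
          ≡⟨ ∑-Δ² _ ⟨
        ∑[ (x , z) ← Δ² ] ∑[ (w , y) ← Δ² ] 𝟙 (x *ᶠ y ≟ z *ᶠ w) ∎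
        where open ≡-Reasoning

      -- A subset only records indices, so richness is known at `element (index ξ)`, which is merely
      -- `≈` to `ξ`; this carries it over.
      E-cong : ∀ {ξ ζ} → ξ ≈ ζ → E A ξ ≡ E A ζ
      E-cong {ξ} {ζ} ξ≈ζ = trans (E≡∑ ξ) (trans (∑-cong Δ² λ (x , z) → 𝟙-≟-resp F.refl (F.*-congʳ ξ≈ζ)) (sym (E≡∑ ζ)))

      private
        ∑-second-zero : ∑[ (x , z) ← Δ² ] 𝟙 (z ≟ 0#) ≡ n ^ 3
        ∑-second-zero = begin
          ∑[ (x , z) ← Δ² ] 𝟙 (z ≟ 0#)          ≡⟨ ∑-Δ² _ ⟩
          ∑[ _ ← Δ ] ∑[ z ← Δ ] 𝟙 (z ≟ 0#)      ≡⟨ ∑-cong Δ (λ _ → ∑-zeros-Δ) ⟩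
          ∑[ _ ← Δ ] n                          ≡⟨ ∑-const-Δ n ⟩
          n ^ 2 * n                             ≡⟨ *-comm (n ^ 2) n ⟩
          n ^ 3                                 ∎
          where open ≡-Reasoning

        ∑-both-zero : ∑[ (x , z) ← Δ² ] [ x , z ]≈0 ≡ n ^ 2
        ∑-both-zero = begin
          ∑[ (x , z) ← Δ² ] [ x , z ]≈0                          ≡⟨ ∑-Δ² _ ⟩
          ∑[ x ← Δ ] ∑[ z ← Δ ] (𝟙 (x ≟ 0#) * 𝟙 (z ≟ 0#))        ≡⟨ ∑-*-∑ Δ Δ _ _ ⟨
          (∑[ x ← Δ ] 𝟙 (x ≟ 0#)) * (∑[ z ← Δ ] 𝟙 (z ≟ 0#))      ≡⟨ cong₂ _*_ ∑-zeros-Δ ∑-zeros-Δ ⟩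
          n * n                                                  ≡⟨ cong (n *_) (*-identityʳ n) ⟨
          n ^ 2                                                  ∎
          where open ≡-Reasoning

        ∑-all : ∑[ _ ← Δ² ] 1 ≡ n ^ 4
        ∑-all = begin
          ∑[ _ ← Δ² ] 1               ≡⟨ ∑-Δ² (λ _ → 1) ⟩
          ∑[ _ ← Δ ] ∑[ _ ← Δ ] 1     ≡⟨ ∑-const-Δ _ ⟩
          n ^ 2 * (∑[ _ ← Δ ] 1)      ≡⟨ cong (n ^ 2 *_) (∑-const-Δ 1) ⟩
          n ^ 2 * (n ^ 2 * 1)         ≡⟨ solve 1 (λ n → n :^ 2 :* (n :^ 2 :* con 1) := n :^ 4) refl n ⟩
          n ^ 4                       ∎
          where
          open ≡-Reasoning
          open +-*-Solver

      -- `single-ratio` summed over all pairs of differences. The n³ pairs with second entry zero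
      -- account for the slope at infinity; the n² pairs with both entries zero lie on all q + 1
      -- slopes instead of one.
      ∑E : ∑[ i ← allFin q ] E A (element i) + n ^ 3 ≡ n ^ 4 + q * n ^ 2
      ∑E = begin
        ∑[ i ← allFin q ] E A (element i) + n ^ 3
          ≡⟨ cong₂ _+_ (trans (∑-cong (allFin q) λ i → E≡∑ (element i)) (∑-swap (allFin q) Δ² _)) (sym ∑-second-zero) ⟩
        ∑[ (x , z) ← Δ² ] ∑[ i ← allFin q ] 𝟙 (x ≟ element i *ᶠ z) + ∑[ (x , z) ← Δ² ] 𝟙 (z ≟ 0#)
          ≡⟨ ∑-+ Δ² _ _ ⟨
        ∑[ (x , z) ← Δ² ] (∑[ i ← allFin q ] 𝟙 (x ≟ element i *ᶠ z) + 𝟙 (z ≟ 0#))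
          ≡⟨ ∑-cong Δ² (λ (x , z) → single-ratio x z) ⟩
        ∑[ (x , z) ← Δ² ] (1 + q * [ x , z ]≈0)
          ≡⟨ ∑-+ Δ² _ _ ⟩
        ∑[ _ ← Δ² ] 1 + ∑[ (x , z) ← Δ² ] (q * [ x , z ]≈0)
          ≡⟨ cong₂ _+_ ∑-all (trans (∑-*ˡ Δ² q _) (cong (q *_) ∑-both-zero)) ⟩
        n ^ 4 + q * n ^ 2 ∎
        where open ≡-Reasoning

      -- A squared energy counts two pairs of differences on the same slope. Adding (n³)² includes
      -- the slope at infinity, after which `common-ratio` applies term by term; its exceptional
      -- term collects the n² · n² choices where both pairs vanish.
      ∑E² : ∑[ i ← allFin q ] (E A (element i) * E A (element i)) + n ^ 6 ≡ D× A + q * n ^ 4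
      ∑E² = begin
        ∑[ i ← allFin q ] (E A (element i) * E A (element i)) + n ^ 6
          ≡⟨ cong₂ _+_ expand n⁶ ⟩
        ∑[ (x , z) ← Δ² ] ∑[ (w , y) ← Δ² ] ratios x z w y
          + ∑[ (x , z) ← Δ² ] ∑[ (w , y) ← Δ² ] (𝟙 (z ≟ 0#) * 𝟙 (y ≟ 0#))
          ≡⟨ ∑∑-+ _ _ ⟨
        ∑[ (x , z) ← Δ² ] ∑[ (w , y) ← Δ² ]
          (ratios x z w y + 𝟙 (z ≟ 0#) * 𝟙 (y ≟ 0#))
          ≡⟨ ∑∑-cong Δ² Δ² (λ (x , z) (w , y) → common-ratio x z w y) ⟩
        ∑[ (x , z) ← Δ² ] ∑[ (w , y) ← Δ² ] (𝟙 (x *ᶠ y ≟ z *ᶠ w) + q * ([ x , z ]≈0 * [ w , y ]≈0))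
          ≡⟨ ∑∑-+ _ _ ⟩
        ∑[ (x , z) ← Δ² ] ∑[ (w , y) ← Δ² ] 𝟙 (x *ᶠ y ≟ z *ᶠ w)
          + ∑[ (x , z) ← Δ² ] ∑[ (w , y) ← Δ² ] (q * ([ x , z ]≈0 * [ w , y ]≈0))
          ≡⟨ cong₂ _+_ (sym D×≡∑) qn⁴ ⟩
        D× A + q * n ^ 4 ∎
        where
        open ≡-Reasoning
        open +-*-Solver
        ∑∑-+ : ∀ (f g : Carrier × Carrier → Carrier × Carrier → ℕ) →
               ∑[ s ← Δ² ] ∑[ t ← Δ² ] (f s t + g s t) ≡ ∑[ s ← Δ² ] ∑[ t ← Δ² ] f s t + ∑[ s ← Δ² ] ∑[ t ← Δ² ] g s t
        ∑∑-+ f g = trans (∑-cong Δ² λ s → ∑-+ Δ² (f s) (g s)) (∑-+ Δ² _ _)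
        expand : ∑[ i ← allFin q ] (E A (element i) * E A (element i)) ≡
          ∑[ (x , z) ← Δ² ] ∑[ (w , y) ← Δ² ] ratios x z w y
        expand = trans
          (∑-cong (allFin q) λ i → trans (cong₂ _*_ (E≡∑ (element i)) (E≡∑ (element i))) (∑-*-∑ Δ² Δ² _ _))
          (trans (∑-swap (allFin q) Δ² _) (∑-cong Δ² λ s → ∑-swap (allFin q) Δ² _))
        n⁶ : n ^ 6 ≡ ∑[ (x , z) ← Δ² ] ∑[ (w , y) ← Δ² ] (𝟙 (z ≟ 0#) * 𝟙 (y ≟ 0#))
        n⁶ = begin
          n ^ 6            ≡⟨ solve 1 (λ n → n :^ 6 := n :^ 3 :* n :^ 3) refl n ⟩
          n ^ 3 * n ^ 3    ≡⟨ cong₂ _*_ ∑-second-zero ∑-second-zero ⟨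
          (∑[ (x , z) ← Δ² ] 𝟙 (z ≟ 0#)) * (∑[ (w , y) ← Δ² ] 𝟙 (y ≟ 0#)) ≡⟨ ∑-*-∑ Δ² Δ² _ _ ⟩
          ∑[ (x , z) ← Δ² ] ∑[ (w , y) ← Δ² ] (𝟙 (z ≟ 0#) * 𝟙 (y ≟ 0#)) ∎
        qn⁴ : ∑[ (x , z) ← Δ² ] ∑[ (w , y) ← Δ² ] (q * ([ x , z ]≈0 * [ w , y ]≈0)) ≡ q * n ^ 4
        qn⁴ = begin
          ∑[ (x , z) ← Δ² ] ∑[ (w , y) ← Δ² ] (q * ([ x , z ]≈0 * [ w , y ]≈0))
            ≡⟨ trans (∑-cong Δ² λ s → ∑-*ˡ Δ² q _) (∑-*ˡ Δ² q _) ⟩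
          q * ∑[ (x , z) ← Δ² ] ∑[ (w , y) ← Δ² ] ([ x , z ]≈0 * [ w , y ]≈0)
            ≡⟨ cong (q *_) (∑-*-∑ Δ² Δ² _ _) ⟨
          q * ((∑[ (x , z) ← Δ² ] [ x , z ]≈0) * (∑[ (w , y) ← Δ² ] [ w , y ]≈0))
            ≡⟨ cong (q *_) (cong₂ _*_ ∑-both-zero ∑-both-zero) ⟩
          q * (n ^ 2 * n ^ 2)
            ≡⟨ solve 2 (λ q n → q :* (n :^ 2 :* n :^ 2) := q :* n :^ 4) refl q n ⟩
          q * n ^ 4 ∎

      private
        E≡∑⁴ : ∀ ξ → E A ξ ≡ ∑[ a ← xs ] ∑[ b ← xs ] ∑[ c ← xs ] ∑[ d ← xs ] 𝟙 (a -ᶠ b ≟ ξ *ᶠ (c -ᶠ d))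
        E≡∑⁴ ξ = trans (E≡∑ ξ) (trans (∑-Δ² _) (trans (∑-Δ _) (∑∑-cong xs xs λ a b → ∑-Δ _)))

      -- Once b, c and d are fixed, the equation determines a, so the sum over a is moved innermost.
      E≤n³ : ∀ ξ → E A ξ ≤ n ^ 3
      E≤n³ ξ = begin
        E A ξ ≡⟨ E≡∑⁴ ξ ⟩
        ∑[ a ← xs ] ∑[ b ← xs ] ∑[ c ← xs ] ∑[ d ← xs ] 𝟙 (a -ᶠ b ≟ ξ *ᶠ (c -ᶠ d))
          ≡⟨ trans (∑-swap xs xs _) (∑-cong xs λ b → trans (∑-swap xs xs _) (∑-cong xs λ c → ∑-swap xs xs _)) ⟩
        ∑[ b ← xs ] ∑[ c ← xs ] ∑[ d ← xs ] ∑[ a ← xs ] 𝟙 (a -ᶠ b ≟ ξ *ᶠ (c -ᶠ d))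
          ≤⟨ ∑-mono xs (λ b → ∑-mono xs λ c → ∑-mono xs λ d → determined b (ξ *ᶠ (c -ᶠ d))) ⟩
        ∑[ b ← xs ] ∑[ c ← xs ] ∑[ d ← xs ] 1
          ≡⟨ trans (∑-const-elements _) (cong (n *_) (trans (∑-const-elements _) (cong (n *_) (∑-const-elements 1)))) ⟩
        n ^ 3 ∎
        where
        open ≤-Reasoning
        determined : ∀ b t → ∑[ a ← xs ] 𝟙 (a -ᶠ b ≟ t) ≤ 1
        determined b t = begin
          ∑[ a ← xs ] 𝟙 (a -ᶠ b ≟ t)
            ≡⟨ ∑-cong xs (λ a → 𝟙-cong (a -ᶠ b ≟ t) (t +ᶠ b ≟ a) (F.sym ∘ proj₁ (x-y≈z⇔x≈z+y a b t)) (proj₂ (x-y≈z⇔x≈z+y a b t) ∘ F.sym)) ⟩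
          ∑[ a ← xs ] 𝟙 (t +ᶠ b ≟ a)    ≡⟨ ∑-membership (t +ᶠ b) ⟩
          𝟙 (index (t +ᶠ b) ∈ᶠ? A)      ≤⟨ 𝟙≤1 (index (t +ᶠ b) ∈ᶠ? A) ⟩
          1                             ∎

      -- Cauchy–Schwarz for the representations u = a + ξ d: a - b = ξ (c - d) is
      -- the collision a + ξ d = b + ξ c.
      n⁴≤qE : ∀ ξ → n ^ 4 ≤ q * E A ξ
      n⁴≤qE ξ = begin
        n ^ 4                   ≡⟨ solve 1 (λ n → n :^ 4 := n :* n :* (n :* n)) refl n ⟩
        n * n * (n * n)         ≡⟨ cong₂ _*_ length-vs length-vs ⟨
        length vs * length vs   ≤⟨ ∑∑-collisions vs ⟩
        q * ∑[ u ← vs ] ∑[ v ← vs ] 𝟙 (u ≟ v)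
          ≡⟨ cong (q *_) (trans (∑-cartesian _ xs xs _) (∑∑-cong xs xs λ a d → ∑-cartesian _ xs xs _)) ⟩
        q * ∑[ a ← xs ] ∑[ d ← xs ] ∑[ b ← xs ] ∑[ c ← xs ] 𝟙 (a +ᶠ ξ *ᶠ d ≟ b +ᶠ ξ *ᶠ c)
          ≡⟨ cong (q *_) (∑-cong xs λ a → trans (∑-swap xs xs _) (∑-cong xs λ b → ∑-swap xs xs _)) ⟩
        q * ∑[ a ← xs ] ∑[ b ← xs ] ∑[ c ← xs ] ∑[ d ← xs ] 𝟙 (a +ᶠ ξ *ᶠ d ≟ b +ᶠ ξ *ᶠ c)
          ≡⟨ cong (q *_) (trans (E≡∑⁴ ξ) (∑∑-cong xs xs λ a b → ∑∑-cong xs xs λ c d → difference-swap ξ a b c d)) ⟨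
        q * E A ξ ∎
        where
        open ≤-Reasoning
        open +-*-Solver
        vs : List Carrier
        vs = cartesianProductWith (λ a d → a +ᶠ ξ *ᶠ d) xs xs
        length-vs : length vs ≡ n * n
        length-vs = begin-equality
          length vs                     ≡⟨ length≡∑1 vs ⟩
          ∑[ _ ← vs ] 1                 ≡⟨ ∑-cartesian _ xs xs _ ⟩
          ∑[ _ ← xs ] ∑[ _ ← xs ] 1     ≡⟨ ∑-const-elements _ ⟩
          n * (∑[ _ ← xs ] 1)           ≡⟨ cong (n *_) (∑-const-elements 1) ⟩
          n * (n * 1)                   ≡⟨ cong (n *_) (*-identityʳ n) ⟩
          n * n                         ∎

      -- The set of rich nonzero slopes.

      private
        subset : {P : Pred (Fin q) 0ℓ} → Decidable P → Subset q
        subset P? = Vec.tabulate (does ∘ P?)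

        ∈-subset⁻ : ∀ {P : Pred (Fin q) 0ℓ} (P? : Decidable P) {i} → i Subset.∈ subset P? → P i
        ∈-subset⁻ P? {i} i∈ with P? i | trans (sym (Vecₚ.lookup∘tabulate (does ∘ P?) i)) (Vecₚ.[]=⇒lookup i∈)
        ... | yes Pi | _ = Pi

        ∈-subset⁺ : ∀ {P : Pred (Fin q) 0ℓ} (P? : Decidable P) {i} → P i → i Subset.∈ subset P?
        ∈-subset⁺ P? {i} Pi = Vecₚ.lookup⇒[]= i _ (trans (Vecₚ.lookup∘tabulate (does ∘ P?) i) (dec-true (P? i) Pi))

        ∣subset∣ : ∀ {P : Pred (Fin q) 0ℓ} (P? : Decidable P) → ∣ subset P? ∣ ≡ ∑[ i ← allFin q ] 𝟙 (P? i)
        ∣subset∣ P? = trans (∣p∣≡∑ (subset P?)) (∑-cong (allFin q) λ i →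
          𝟙-cong (i ∈ᶠ? subset P?) (P? i) (∈-subset⁻ P?) (∈-subset⁺ P?))

      -- With K₀ = 3 q² n⁵ / M the last three conclusions are E ≥ n³/K₀, q/(K₀ n) ≤ |X| and |X| ≤ 4
      -- K₀ q/(3n), cleared of denominators.
      richSlopes : .{{_ : NonZero q}} .{{_ : NonZero n}} → ∀ {M} →
        M + n ^ 8 ≡ q * D× A → 12 * (q * n ^ 6) ≤ M →
        ∃[ X ]
          (∀ ξ → ξ FS.∈ X → FS.NonZeroElement ξ) ×
          (∀ ξ → ξ FS.∈ X → M ≤ 3 * (q * q * n ^ 2) * E A ξ) ×
          M ≤ 3 * (q * n ^ 6) * ∣ X ∣ ×
          ∣ X ∣ * M ≤ 4 * (q * q * q * n ^ 4)
      richSlopes {M} M-def 12qn⁶≤M =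
        X , X-nonZero , X-rich , #rich-lower ∣ X ∣ (subst (_≤ suc ∣ X ∣) ∣Y∣ (∣p∣≤1+∣p-x∣ Y (index 0#)))
          , ≤-trans (*-monoˡ-≤ M ∣X∣≤) #rich-upper
        where
        open Arithmetic (allFin q) (λ i → E A (element i)) q n (D× A) M (length-allFin q)
          ∑E ∑E² (λ i → n⁴≤qE (element i)) (λ i → E≤n³ (element i)) M-def 12qn⁶≤M
        Y X : Subset q
        Y = subset isRich?
        -- At ξ = 0 the energy takes its maximal value n³, yet only nonzero slopes are wanted.
        -- Deleting this index lowers the count by at most one, as `#rich-lower` allows.
        X = Y ∖ index 0#
        ∣Y∣ : ∣ Y ∣ ≡ #rich
        ∣Y∣ = ∣subset∣ isRich?
        ∣X∣≤ : ∣ X ∣ ≤ #rich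
        ∣X∣≤ = subst (∣ X ∣ ≤_) ∣Y∣ (Subsetₚ.∣p─q∣≤∣p∣ Y ⁅ index 0# ⁆)
        X-nonZero : ∀ ξ → ξ FS.∈ X → FS.NonZeroElement ξ
        X-nonZero ξ ξ∈X ξ≈0 = x∉p-x Y (subst (Subset._∈ X) (index-cong ξ≈0) ξ∈X)
        X-rich : ∀ ξ → ξ FS.∈ X → M ≤ 3 * (q * q * n ^ 2) * E A ξ
        X-rich ξ ξ∈X = subst (λ t → M ≤ 3 * (q * q * n ^ 2) * t) (E-cong (element-index ξ))
          (∈-subset⁻ isRich? (Subsetₚ.p─q⊆p Y ⁅ index 0# ⁆ ξ∈X))

-- Inequalities in a constructive ordered field.

module OrderedFieldProperties {c ℓ₁ ℓ₂ ℓ₃} (R : OrderedField c ℓ₁ ℓ₂ ℓ₃) where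

  open OrderedField R
  open GroupProperties (CommutativeRing.+-group commutativeRing)
  open CommutativeSemigroupProperties (CommutativeRing.*-commutativeSemigroup commutativeRing)

  -- If neither alternative held, x and y could not be apart, and tightness would make them equal.
  -- The double negation costs nothing in proofs of `≤`, which is itself a negation.
  ≤⇒¬¬<⊎≈ : ∀ {x y} → x ≤ y → ¬ ¬ (x < y ⊎ x ≈ y)
  ≤⇒¬¬<⊎≈ {x} {y} x≤y ¬<⊎≈ = ¬<⊎≈ (inj₂ (proj₁ (tight x y) λ x#y → x≮y⊎y≮x (#⇒<⊎> x#y)))
    where
    x≮y⊎y≮x : ¬ (x < y ⊎ y < x)
    x≮y⊎y≮x (inj₁ x<y) = ¬<⊎≈ (inj₁ x<y)
    x≮y⊎y≮x (inj₂ y<x) = x≤y y<x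

  ≤-reflexive : ∀ {x y} → x ≈ y → x ≤ y
  ≤-reflexive x≈y = <-Order.irrefl (sym x≈y)

  <⇒≤ : ∀ {x y} → x < y → x ≤ y
  <⇒≤ = <-Order.asym

  ≤-trans : ∀ {x y z} → x ≤ y → y ≤ z → x ≤ z
  ≤-trans x≤y y≤z z<x = ≤⇒¬¬<⊎≈ x≤y λ
    { (inj₁ x<y) → y≤z (<-Order.trans z<x x<y)
    ; (inj₂ x≈y) → y≤z (<-Order.<-respʳ-≈ x≈y z<x)
    }

  ≤-resp-≈ : ∀ {x x′ y y′} → x ≈ x′ → y ≈ y′ → x ≤ y → x′ ≤ y′
  ≤-resp-≈ x≈x′ y≈y′ x≤y = ≤-trans (≤-reflexive (sym x≈x′)) (≤-trans x≤y (≤-reflexive y≈y′))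

  +-monoˡ-≤ : ∀ z {x y} → x ≤ y → x + z ≤ y + z
  +-monoˡ-≤ z {x} {y} x≤y y+z<x+z = x≤y
    (<-Order.<-respˡ-≈ (//-rightDividesʳ z y) (<-Order.<-respʳ-≈ (//-rightDividesʳ z x) (+-monoˡ-< (- z) y+z<x+z)))

  +-monoʳ-≤ : ∀ z {x y} → x ≤ y → z + x ≤ z + y
  +-monoʳ-≤ z {x} {y} x≤y = ≤-resp-≈ (+-comm x z) (+-comm y z) (+-monoˡ-≤ z x≤y)

  +-cancelʳ-≤ : ∀ z {x y} → x + z ≤ y + z → x ≤ y
  +-cancelʳ-≤ z x+z≤y+z y<x = x+z≤y+z (+-monoˡ-< z y<x)

  *-monoˡ-< : ∀ {z} → 0# < z → ∀ {x y} → x < y → x * z < y * z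
  *-monoˡ-< {z} 0<z {x} {y} x<y = <-Order.<-respˡ-≈ (+-identityˡ (x * z)) (<-Order.<-respʳ-≈ yz (+-monoˡ-< (x * z) 0<[y-x]z))
    where
    0<[y-x]z : 0# < (y - x) * z
    0<[y-x]z = 0<* (<-Order.<-respˡ-≈ (-‿inverseʳ x) (+-monoˡ-< (- x) x<y)) 0<z
    yz : (y - x) * z + x * z ≈ y * z
    yz = trans (sym (distribʳ z (y - x) x)) (*-congʳ (//-rightDividesˡ x y))

  *-monoˡ-≤ : ∀ {z} → 0# < z → ∀ {x y} → x ≤ y → x * z ≤ y * z
  *-monoˡ-≤ 0<z x≤y yz<xz = ≤⇒¬¬<⊎≈ x≤y λ
    { (inj₁ x<y) → <-Order.asym yz<xz (*-monoˡ-< 0<z x<y)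
    ; (inj₂ x≈y) → <-Order.irrefl (sym (*-congʳ x≈y)) yz<xz
    }

  *-cancelʳ-≤ : ∀ {z} → 0# < z → ∀ {x y} → x * z ≤ y * z → x ≤ y
  *-cancelʳ-≤ 0<z xz≤yz y<x = xz≤yz (*-monoˡ-< 0<z y<x)

  /-*-cancel : ∀ x y₊ → x / y₊ * proj₁ y₊ ≈ x
  /-*-cancel x (y , 0<y) = let u , u[y-0]≈1 , _ = #⇒invertible (#-sym (<⇒# 0<y)) in
    -- Apartness of `y` from `0#` provides an inverse of the difference `y - 0#`, which has to be
    -- replaced by `y`.
    trans (*-assoc x u y) (trans (*-congˡ (trans (*-congˡ (sym (HeytingProperties.x-0≈x heytingCommutativeRing y))) u[y-0]≈1)) (*-identityʳ x))

  ≤/⇒*≤ : ∀ {x z} y₊ → x ≤ z / y₊ → x * proj₁ y₊ ≤ z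
  ≤/⇒*≤ {x} {z} y₊ x≤z/y = ≤-resp-≈ refl (/-*-cancel z y₊) (*-monoˡ-≤ (proj₂ y₊) x≤z/y)

  *≤⇒≤/ : ∀ {x z} y₊ → x * proj₁ y₊ ≤ z → x ≤ z / y₊
  *≤⇒≤/ {x} {z} y₊ xy≤z = *-cancelʳ-≤ (proj₂ y₊) (≤-resp-≈ refl (sym (/-*-cancel z y₊)) xy≤z)

  ≤*⇒/≤ : ∀ {x z} y₊ → z ≤ x * proj₁ y₊ → z / y₊ ≤ x
  ≤*⇒/≤ {x} {z} y₊ z≤xy = *-cancelʳ-≤ (proj₂ y₊) (≤-resp-≈ (sym (/-*-cancel z y₊)) refl z≤xy)

  ⟦⟧-homo-+ : ∀ m n → ⟦ m ℕ.+ n ⟧ ≈ ⟦ m ⟧ + ⟦ n ⟧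
  ⟦⟧-homo-+ = MonoidMult.×-homo-+ (CommutativeRing.+-monoid commutativeRing) 1#

  ⟦⟧-homo-* : ∀ m n → ⟦ m ℕ.* n ⟧ ≈ ⟦ m ⟧ * ⟦ n ⟧
  ⟦⟧-homo-* = SemiringMult.×1-homo-* (CommutativeRing.semiring commutativeRing)

  0≤⟦_⟧ : ∀ n → 0# ≤ ⟦ n ⟧
  0≤⟦ zero ⟧  = ≤-reflexive refl
  0≤⟦ suc n ⟧ = <⇒≤ 0<⟦ suc n ⟧

  ⟦⟧-mono-≤ : ∀ {m n} → m ℕ.≤ n → ⟦ m ⟧ ≤ ⟦ n ⟧
  ⟦⟧-mono-≤ {m} m≤n with k , ≡.refl ← ℕₚ.m≤n⇒∃[o]m+o≡n m≤n =
    ≤-resp-≈ (+-identityʳ ⟦ m ⟧) (sym (⟦⟧-homo-+ m k)) (+-monoʳ-≤ ⟦ m ⟧ 0≤⟦ k ⟧)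

  -- The way back from `R` to `ℕ` once K has been cancelled.
  ⟦⟧-cancel-≤ : ∀ {m n} → ⟦ m ⟧ ≤ ⟦ n ⟧ → m ℕ.≤ n
  ⟦⟧-cancel-≤ {m} {n} ⟦m⟧≤⟦n⟧ = ℕₚ.≮⇒≥ λ n<m → ≤-trans (⟦⟧-mono-≤ n<m) ⟦m⟧≤⟦n⟧
    (<-Order.<-respˡ-≈ (+-identityˡ ⟦ n ⟧) (+-monoˡ-< ⟦ n ⟧ 0<1))

  module Scaled {K} (0<K : 0# < K) where

    infix 4 _≼_

    -- For positive `b` this is the lower bound a/b ≤ K, written without division.
    _≼_ : ℕ → ℕ → Set ℓ₃
    a ≼ b = ⟦ a ⟧ ≤ ⟦ b ⟧ * K

    ≼-mono : ∀ {a a′ b b′} → a′ ℕ.≤ a → b ℕ.≤ b′ → a ≼ b → a′ ≼ b′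
    ≼-mono a′≤a b≤b′ a≼b = ≤-trans (⟦⟧-mono-≤ a′≤a) (≤-trans a≼b (*-monoˡ-≤ 0<K (⟦⟧-mono-≤ b≤b′)))

    private
      scale : ∀ c b → ⟦ b ⟧ * K * ⟦ c ⟧ ≈ ⟦ c ℕ.* b ⟧ * K
      scale c b = trans (xy∙z≈zx∙y ⟦ b ⟧ K ⟦ c ⟧) (*-congʳ (sym (⟦⟧-homo-* c b)))

      scale′ : ∀ c a → ⟦ a ⟧ * ⟦ c ⟧ ≈ ⟦ c ℕ.* a ⟧
      scale′ c a = trans (*-comm ⟦ a ⟧ ⟦ c ⟧) (sym (⟦⟧-homo-* c a))

    ≼-scale : ∀ c {a b} → a ≼ b → c ℕ.* a ≼ c ℕ.* b
    ≼-scale zero        a≼b = ≤-reflexive (sym (zeroˡ K))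
    ≼-scale c@(suc _) {a} {b} a≼b = ≤-resp-≈ (scale′ c a) (scale c b) (*-monoˡ-≤ 0<⟦ c ⟧ a≼b)

    ≽-scale : ∀ c {a b} → ⟦ a ⟧ * K ≤ ⟦ b ⟧ → ⟦ c ℕ.* a ⟧ * K ≤ ⟦ c ℕ.* b ⟧
    ≽-scale zero              aK≤b = ≤-reflexive (zeroˡ K)
    ≽-scale c@(suc _) {a} {b} aK≤b = ≤-resp-≈ (scale c a) (scale′ c b) (*-monoˡ-≤ 0<⟦ c ⟧ aK≤b)

    ≼-cancel : ∀ c .{{_ : ℕ.NonZero c}} {a b} → c ℕ.* a ≼ c ℕ.* b → a ≼ b
    ≼-cancel c {a} {b} ca≼cb = *-cancelʳ-≤ 0<⟦ c ⟧ (≤-resp-≈ (sym (scale′ c a)) (sym (scale c b)) ca≼cb)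

theoremB :
    ∀ {c ℓ₁ ℓ₂ r ℓ₃ ℓ₄ ℓ₅} (q : ℕ) (q-primePower : IsPrimePower q)
    (F : FiniteField c ℓ₁ ℓ₂ q) (R : OrderedField r ℓ₃ ℓ₄ ℓ₅) →
    let open FieldSubsets F
        open OrderedField R
    in
    (A : Subset q) (A-nonempty : Nonempty A)
    (K : Carrier) (0<K : 0# < K) →
    let q₊ = ⟦ q ⟧₊ {{primePower⇒nonZero q-primePower}}
        ∣A∣₊ = ⟦ ∣ A ∣ ⟧₊ {{nonempty⇒nonZero A-nonempty}}
        K₊ = (K , 0<K)
    in
    ⟦ ∣ A ∣ ⟧ ≤ ⟦ q ⟧ / (⟦ 4 ⟧₊ *₊ K₊) →
    ⟦ D× A ⟧ ≥ ⟦ ∣ A ∣ ^ 8 ⟧ / q₊ + (⟦ 3 ⟧ * ⟦ q ⟧ * ⟦ ∣ A ∣ ^ 5 ⟧) / K₊ →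
    ∃[ X ]
      (∀ ξ → ξ ∈ X → NonZeroElement ξ) ×
      (∀ ξ → ξ ∈ X → ⟦ E A ξ ⟧ ≥ ⟦ ∣ A ∣ ^ 3 ⟧ / K₊) ×
      ⟦ q ⟧ / (K₊ *₊ ∣A∣₊) ≤ ⟦ ∣ X ∣ ⟧ ×
      ⟦ ∣ X ∣ ⟧ ≤ (⟦ 4 ⟧ * K * ⟦ q ⟧) / (⟦ 3 ⟧₊ *₊ ∣A∣₊)
theoremB q q-primePower F R A A-nonempty K 0<K small large =
  X , X-nonZero , X-energy , X-lower , X-upper
  where
  open FieldSubsets F using (_∈_; E; D×)
  open OrderedField R
  open OrderedFieldProperties R
  open Scaled 0<K
  open CommutativeSemigroupProperties (CommutativeRing.*-commutativeSemigroup commutativeRing)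
  open +-*-Solver using (solve; con; _:+_; _:*_; _:^_; _:=_)

  n D : ℕ
  n = ∣ A ∣
  D = D× A

  instance
    q≢0 : ℕ.NonZero q
    q≢0 = primePower⇒nonZero q-primePower
    n≢0 : ℕ.NonZero n
    n≢0 = nonempty⇒nonZero A-nonempty

  K₊ : Positive
  K₊ = K , 0<K

  4nK≤q : ⟦ 4 ℕ.* n ⟧ * K ≤ ⟦ q ⟧
  4nK≤q = ≤-resp-≈ (trans (x∙yz≈yx∙z ⟦ n ⟧ ⟦ 4 ⟧ K) (*-congʳ (sym (⟦⟧-homo-* 4 n)))) refl
    (≤/⇒*≤ (⟦ 4 ⟧₊ *₊ K₊) small)

  12qn⁶K≤3q²n⁵ : ⟦ 12 ℕ.* (q ℕ.* n ^ 6) ⟧ * K ≤ ⟦ 3 ℕ.* (q ℕ.* q) ℕ.* n ^ 5 ⟧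
  12qn⁶K≤3q²n⁵ = ≡.subst₂ (λ a b → ⟦ a ⟧ * K ≤ ⟦ b ⟧)
    (solve 2 (λ q n → con 3 :* (q :* n :^ 5) :* (con 4 :* n) := con 12 :* (q :* n :^ 6)) ≡.refl q n)
    (solve 2 (λ q n → con 3 :* (q :* n :^ 5) :* q := con 3 :* (q :* q) :* n :^ 5) ≡.refl q n)
    (≽-scale (3 ℕ.* (q ℕ.* n ^ 5)) 4nK≤q)

  n⁸K+3q²n⁵≤qDK : ⟦ n ^ 8 ⟧ * K + ⟦ 3 ℕ.* (q ℕ.* q) ℕ.* n ^ 5 ⟧ ≤ ⟦ q ℕ.* D ⟧ * K
  n⁸K+3q²n⁵≤qDK = ≤-resp-≈ clear-denominators (trans (x∙yz≈yx∙z ⟦ D ⟧ ⟦ q ⟧ K) (*-congʳ (sym (⟦⟧-homo-* q D))))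
    (*-monoˡ-≤ (0<* 0<⟦ q ⟧ 0<K) large)
    where
    open SetoidReasoning setoid
    u v w : Carrier
    u = ⟦ n ^ 8 ⟧ / ⟦ q ⟧₊
    w = ⟦ 3 ⟧ * ⟦ q ⟧ * ⟦ n ^ 5 ⟧
    v = w / K₊
    3q²n⁵ : w * ⟦ q ⟧ ≈ ⟦ 3 ℕ.* (q ℕ.* q) ℕ.* n ^ 5 ⟧
    3q²n⁵ = begin
      ⟦ 3 ⟧ * ⟦ q ⟧ * ⟦ n ^ 5 ⟧ * ⟦ q ⟧      ≈⟨ *-congʳ (*-congʳ (⟦⟧-homo-* 3 q)) ⟨
      ⟦ 3 ℕ.* q ⟧ * ⟦ n ^ 5 ⟧ * ⟦ q ⟧        ≈⟨ *-congʳ (⟦⟧-homo-* (3 ℕ.* q) (n ^ 5)) ⟨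
      ⟦ 3 ℕ.* q ℕ.* n ^ 5 ⟧ * ⟦ q ⟧          ≈⟨ ⟦⟧-homo-* (3 ℕ.* q ℕ.* n ^ 5) q ⟨
      ⟦ 3 ℕ.* q ℕ.* n ^ 5 ℕ.* q ⟧
        ≡⟨ ≡.cong ⟦_⟧ (solve 2 (λ q n → con 3 :* q :* n :^ 5 :* q
              := con 3 :* (q :* q) :* n :^ 5) ≡.refl q n) ⟩
      ⟦ 3 ℕ.* (q ℕ.* q) ℕ.* n ^ 5 ⟧          ∎
    clear-denominators : (u + v) * (⟦ q ⟧ * K) ≈ ⟦ n ^ 8 ⟧ * K + ⟦ 3 ℕ.* (q ℕ.* q) ℕ.* n ^ 5 ⟧
    clear-denominators = begin
      (u + v) * (⟦ q ⟧ * K)             ≈⟨ distribʳ (⟦ q ⟧ * K) u v ⟩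
      u * (⟦ q ⟧ * K) + v * (⟦ q ⟧ * K) ≈⟨ +-cong (sym (*-assoc u ⟦ q ⟧ K)) (x∙yz≈xz∙y v ⟦ q ⟧ K) ⟩
      u * ⟦ q ⟧ * K + v * K * ⟦ q ⟧
        ≈⟨ +-cong (*-congʳ (/-*-cancel ⟦ n ^ 8 ⟧ ⟦ q ⟧₊)) (*-congʳ (/-*-cancel w K₊)) ⟩
      ⟦ n ^ 8 ⟧ * K + w * ⟦ q ⟧         ≈⟨ +-congˡ 3q²n⁵ ⟩
      ⟦ n ^ 8 ⟧ * K + ⟦ 3 ℕ.* (q ℕ.* q) ℕ.* n ^ 5 ⟧ ∎

  -- The hypotheses meet at 3 q² n⁵: the first bounds it below by 12 q n⁶ K, the second above by (q
  -- D - n⁸) K, and K cancels. In particular n⁸ ≤ q D, so the subtraction defining `M` is not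
  -- truncated.
  12qn⁶+n⁸≤qD : 12 ℕ.* (q ℕ.* n ^ 6) ℕ.+ n ^ 8 ℕ.≤ q ℕ.* D
  12qn⁶+n⁸≤qD = ⟦⟧-cancel-≤ (*-cancelʳ-≤ 0<K (≤-trans (≤-reflexive homo)
    (≤-trans (+-monoʳ-≤ (⟦ n ^ 8 ⟧ * K) 12qn⁶K≤3q²n⁵) n⁸K+3q²n⁵≤qDK)))
    where
    homo : ⟦ 12 ℕ.* (q ℕ.* n ^ 6) ℕ.+ n ^ 8 ⟧ * K ≈ ⟦ n ^ 8 ⟧ * K + ⟦ 12 ℕ.* (q ℕ.* n ^ 6) ⟧ * K
    homo = trans (*-congʳ (trans (⟦⟧-homo-+ (12 ℕ.* (q ℕ.* n ^ 6)) (n ^ 8)) (+-comm _ _))) (distribʳ K _ _)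

  M : ℕ
  M = q ℕ.* D ℕ.∸ n ^ 8

  M+n⁸≡qD : M ℕ.+ n ^ 8 ≡ q ℕ.* D
  M+n⁸≡qD = ℕₚ.m∸n+n≡m (ℕₚ.m+n≤o⇒n≤o (12 ℕ.* (q ℕ.* n ^ 6)) 12qn⁶+n⁸≤qD)

  12qn⁶≤M : 12 ℕ.* (q ℕ.* n ^ 6) ℕ.≤ M
  12qn⁶≤M = ℕₚ.m+n≤o⇒m≤o∸n _ 12qn⁶+n⁸≤qD

  -- K is at least the rational number K₀ = 3 q² n⁵ / M, and the theorem for K
  -- follows from the one for K₀.
  3q²n⁵≼M : 3 ℕ.* (q ℕ.* q) ℕ.* n ^ 5 ≼ M
  3q²n⁵≼M = +-cancelʳ-≤ (⟦ n ^ 8 ⟧ * K) (≤-resp-≈ (+-comm _ _) homo n⁸K+3q²n⁵≤qDK)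
    where
    homo : ⟦ q ℕ.* D ⟧ * K ≈ ⟦ M ⟧ * K + ⟦ n ^ 8 ⟧ * K
    homo = trans (*-congʳ (trans (reflexive (≡.cong ⟦_⟧ (≡.sym M+n⁸≡qD))) (⟦⟧-homo-+ M (n ^ 8)))) (distribʳ K _ _)

  rich = Counting.FieldCounting.Energy.richSlopes F A M+n⁸≡qD 12qn⁶≤M

  X : Subset q
  X = proj₁ rich

  X-nonZero : ∀ ξ → ξ ∈ X → FieldSubsets.NonZeroElement F ξ
  X-nonZero = proj₁ (proj₂ rich)

  X-energy : ∀ ξ → ξ ∈ X → ⟦ n ^ 3 ⟧ / K₊ ≤ ⟦ E A ξ ⟧
  -- Here and in the two bounds on |X|, `3q²n⁵≼M` is chained with a conclusion of `richSlopes`, and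
  -- the common factor of both ends is cancelled: now 3 q² n², later 3 q n⁵ and q² n⁴.
  X-energy ξ ξ∈X = ≤*⇒/≤ K₊ (≼-cancel (3 ℕ.* (q ℕ.* q ℕ.* n ^ 2)) {{3q²n²≢0}} (≼-mono
    (ℕₚ.≤-reflexive (solve 2 (λ q n → con 3 :* (q :* q :* n :^ 2) :* n :^ 3
              := con 3 :* (q :* q) :* n :^ 5) ≡.refl q n))
    (proj₁ (proj₂ (proj₂ rich)) ξ ξ∈X) 3q²n⁵≼M))
    where
    3q²n²≢0 : ℕ.NonZero (3 ℕ.* (q ℕ.* q ℕ.* n ^ 2))
    3q²n²≢0 = ℕₚ.m*n≢0 3 _ {{it}} {{ℕₚ.m*n≢0 _ _ {{ℕₚ.m*n≢0 q q}} {{ℕₚ.m^n≢0 n 2}}}}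

  q≼∣X∣n : q ≼ ∣ X ∣ ℕ.* n
  q≼∣X∣n = ≼-cancel (3 ℕ.* (q ℕ.* n ^ 5)) {{3qn⁵≢0}} (≼-mono
    (ℕₚ.≤-reflexive (solve 2 (λ q n → con 3 :* (q :* n :^ 5) :* q := con 3 :* (q :* q) :* n :^ 5) ≡.refl q n))
    (ℕₚ.≤-trans (proj₁ (proj₂ (proj₂ (proj₂ rich)))) (ℕₚ.≤-reflexive
      (solve 3 (λ q n x → con 3 :* (q :* n :^ 6) :* x
              := con 3 :* (q :* n :^ 5) :* (x :* n)) ≡.refl q n ∣ X ∣)))
    3q²n⁵≼M)
    where
    3qn⁵≢0 : ℕ.NonZero (3 ℕ.* (q ℕ.* n ^ 5))
    3qn⁵≢0 = ℕₚ.m*n≢0 3 _ {{it}} {{ℕₚ.m*n≢0 q _ {{it}} {{ℕₚ.m^n≢0 n 5}}}}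

  X-lower : ⟦ q ⟧ / (K₊ *₊ ⟦ n ⟧₊) ≤ ⟦ ∣ X ∣ ⟧
  X-lower = ≤*⇒/≤ (K₊ *₊ ⟦ n ⟧₊) (≤-resp-≈ refl (begin
    ⟦ ∣ X ∣ ℕ.* n ⟧ * K       ≈⟨ *-congʳ (⟦⟧-homo-* ∣ X ∣ n) ⟩
    ⟦ ∣ X ∣ ⟧ * ⟦ n ⟧ * K     ≈⟨ xy∙z≈x∙zy _ _ _ ⟩
    ⟦ ∣ X ∣ ⟧ * (K * ⟦ n ⟧)   ∎) q≼∣X∣n)
    where open SetoidReasoning setoid

  3n∣X∣≼4q : ∣ X ∣ ℕ.* (3 ℕ.* n) ≼ 4 ℕ.* q
  3n∣X∣≼4q = ≼-cancel (q ℕ.* q ℕ.* n ^ 4) {{q²n⁴≢0}} (≼-mono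
    (ℕₚ.≤-reflexive (solve 3 (λ q n x → q :* q :* n :^ 4 :* (x :* (con 3 :* n))
              := x :* (con 3 :* (q :* q) :* n :^ 5)) ≡.refl q n ∣ X ∣))
    (ℕₚ.≤-trans (proj₂ (proj₂ (proj₂ (proj₂ rich)))) (ℕₚ.≤-reflexive
      (solve 2 (λ q n → con 4 :* (q :* q :* q :* n :^ 4) := q :* q :* n :^ 4 :* (con 4 :* q)) ≡.refl q n)))
    (≼-scale ∣ X ∣ 3q²n⁵≼M))
    where
    q²n⁴≢0 : ℕ.NonZero (q ℕ.* q ℕ.* n ^ 4)
    q²n⁴≢0 = ℕₚ.m*n≢0 _ _ {{ℕₚ.m*n≢0 q q}} {{ℕₚ.m^n≢0 n 4}}

  X-upper : ⟦ ∣ X ∣ ⟧ ≤ (⟦ 4 ⟧ * K * ⟦ q ⟧) / (⟦ 3 ⟧₊ *₊ ⟦ n ⟧₊)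
  X-upper = *≤⇒≤/ (⟦ 3 ⟧₊ *₊ ⟦ n ⟧₊) (≤-resp-≈
    (trans (⟦⟧-homo-* ∣ X ∣ (3 ℕ.* n)) (*-congˡ (⟦⟧-homo-* 3 n)))
    (trans (*-congʳ (⟦⟧-homo-* 4 q)) (xy∙z≈xz∙y ⟦ 4 ⟧ ⟦ q ⟧ K))
    3n∣X∣≼4q)
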